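{- Let $q>3$ be a prime power and let $\mathcal{X}$ be the Cartan scheme of the group $\mathrm{PSL}(2,q)$. Then $\mathcal{X}$ is $2$-separable and $b(\mathcal{X})=2$.
   Context: **Cartan scheme.** The Cartan subgroup $H$ of $G=\mathrm{PSL}(2,q)$ is the image in $G$ of the subgroup of diagonal matrices of $\mathrm{SL}(2,q)$. The Cartan scheme of $G$ is $\mathrm{Inv}(G,\Omega)$, where $\Omega=G/H$ is the set of right cosets of $H$ in $G$, on which $G$ acts by right multiplication, and $\mathrm{Inv}(G,\Omega)=(\Omega,S)$ with $S$ the set of orbits of $G$ on $\Omega\times\Omega$. **Coherent configurations.** Let $\Omega$ be a finite set. For $r\subseteq\Omega\times\Omega$ and $\alpha\in\Omega$ put $r^*=\{(\beta,\alpha):(\alpha,\beta)\in r\}$ and $\alpha r=\{\beta:(\alpha,\beta)\in r\}$; $1_\Omega$ is the diagonal of $\Omega\times\Omega$. A coherent configuration on $\Omega$ is a pair $\mathcal{X}=(\Omega,S)$, where $S$ is a partition of $\Omega\times\Omega$ such that $1_\Omega$ is a union of elements of $S$, $s^*\in S$ for all $s\in S$, and for all $r,s,t\in S$ the intersection number $c_{rs}^t=|\alpha r\cap\beta s^*|$ does not depend on $(\alpha,\beta)\in t$. The elements of $S$ are the basis relations, unions of them are the relations; a fiber is a set $\Gamma\subseteq\Omega$ with $1_\Gamma=\{(\gamma,\gamma):\gamma\in\Gamma\}\in S$. For coherent configurations on the same set, $\mathcal{X}\le\mathcal{X}'$ means that every relation of $\mathcal{X}$ is a relation of $\mathcal{X}'$;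 "smallest" refers to this order. **Base number.** $\mathcal{X}$ is complete if all its basis relations are singletons. The point extension $\mathcal{X}_{\alpha,\beta,\ldots}$ is the smallest coherent configuration on $\Omega$ that is $\ge\mathcal{X}$ and has $\{(\alpha,\alpha)\},\{(\beta,\beta)\},\ldots$ as relations. A set $\{\alpha,\beta,\ldots\}\subseteq\Omega$ is a base of $\mathcal{X}$ if $\mathcal{X}_{\alpha,\beta,\ldots}$ is complete; $b(\mathcal{X})$ is the smallest cardinality of a base. **Separability.** An algebraic isomorphism from $\mathcal{X}=(\Omega,S)$ to $\mathcal{X}'=(\Omega',S')$ is a bijection $\varphi:S\to S'$, $r\mapsto r'$, with $c_{rs}^t=c_{r's'}^{t'}$ for all $r,s,t\in S$; it extends naturally to relations. It is induced by an isomorphism if there is a bijection $f:\Omega\to\Omega'$ with $\{(\alpha^f,\beta^f):(\alpha,\beta)\in s\}=\varphi(s)$ for all $s\in S$. The $m$-extension of $\mathcal{X}$ is the smallest coherent configuration on $\Omega^m$ that contains the Cartesian $m$-power $\mathcal{X}^m$ of $\mathcal{X}$ and for which $\mathrm{Diag}(\Omega^m)=\{(\alpha,\ldots,\alpha):\alpha\in\Omega\}$ is a union of fibers. An algebraic isomorphism $\varphi:\mathcal{X}\to\mathcal{X}'$ is $m$-dimensional if there is an algebraic isomorphism from the $m$-extension of $\mathcal{X}$ to the $m$-extension of $\mathcal{X}'$ that takes $1_{\mathrm{Diag}(\Omega^m)}$ to $1_{\mathrm{Diag}(\Omega'^m)}$ and takes each relation $s_1\times\cdots\times s_m$ of $\mathcal{X}^m$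 ($s_i\in S$) to $\varphi(s_1)\times\cdots\times\varphi(s_m)$. $\mathcal{X}$ is $m$-separable if every $m$-dimensional algebraic isomorphism from $\mathcal{X}$ to another coherent configuration is induced by an isomorphism. -}

module Defs where

open import Algebra.Bundles using (CommutativeRing; Group)
import Algebra.Properties.AbelianGroup as AbelianGroupProperties
import Algebra.Properties.Group as GroupProperties
import Algebra.Properties.Ring as RingProperties
import Algebra.Solver.Ring.NaturalCoefficients.Default as NaturalSolver
open import Data.Fin.Base using (Fin; zero; suc)
import Data.Fin.Properties as Fin
open import Data.List.Base using (List; []; _∷_; length; filter; map; deduplicate; cartesianProduct; cartesianProductWith; allFin; lookup)
open import Data.List.Properties using (length-map)
import Data.List.Membership.Setoid as Membership
import Data.List.Membership.Setoid.Properties as Membershipₚ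
import Data.List.Membership.Propositional.Properties as Membership≡ₚ
open import Data.List.Relation.Unary.All using (All; []; _∷_)
import Data.List.Relation.Unary.All as All
open import Data.List.Relation.Unary.AllPairs using ([]; _∷_)
open import Data.List.Relation.Unary.Any using (Any; here; there; index)
import Data.List.Relation.Unary.Any as Any
open import Data.List.Relation.Unary.Enumerates.Setoid using (IsEnumeration)
import Data.List.Relation.Unary.Enumerates.Setoid.Properties as Enumeratesₚ
open import Data.List.Relation.Unary.Unique.DecSetoid.Properties using (deduplicate-!)
open import Data.List.Relation.Unary.Unique.Setoid using (Unique)
import Data.List.Relation.Unary.Unique.Setoid.Properties as Uniqueₚ
open import Data.Nat.Base using (ℕ; zero; suc; _≤_; _≥_; _^_)
import Data.Nat.Properties as ℕ
open import Data.Nat.Primality using (Prime)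
open import Data.Product.Base using (Σ-syntax; ∃-syntax; ∃₂; _×_; _,_; proj₁; proj₂)
open import Data.Product.Relation.Binary.Pointwise.NonDependent using (_×ₛ_)
open import Data.Sum.Base using (_⊎_; inj₁; inj₂)
open import Data.Vec.Base as Vec using (Vec; []; _∷_; replicate)
import Data.Vec.Relation.Binary.Pointwise.Inductive as Pointwise
open import Data.Vec.Relation.Binary.Pointwise.Inductive using ([]; _∷_)
open import Function.Base using (_∘_)
open import Function.Bundles using (Bijection; Inverse)
open import Level using (0ℓ)
open import Relation.Binary.Bundles using (Setoid; DecSetoid)
open import Relation.Binary.Core using (Rel)
open import Relation.Binary.Definitions using (Decidable; _Respects_)
open import Relation.Binary.PropositionalEquality.Core as ≡ using (_≡_)
import Relation.Binary.PropositionalEquality.Properties as ≡ using (setoid)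
import Relation.Binary.Reasoning.Setoid as SetoidReasoning
open import Relation.Binary.Structures using (IsDecEquivalence)
open import Relation.Nullary.Decidable using (yes; no; _×-dec_; _⊎-dec_; map′)
open import Relation.Nullary.Negation using (¬_; contradiction)
open import Relation.Unary using (Pred; _≐_; _⊆_; ⋃)
import Relation.Unary as U

-- `elements` lists every point exactly once up to _≈_.
record FiniteSet : Set₁ where
  field
    decSetoid : DecSetoid 0ℓ 0ℓ

  open DecSetoid decSetoid public

  field
    elements : List Carrier
    complete : IsEnumeration setoid elements
    unique   : Unique setoid elements

  count : {P : Pred Carrier 0ℓ} → U.Decidable P → ℕ
  count P? = length (filter P? elements)

fromEnumeration : (D : DecSetoid 0ℓ 0ℓ) (xs : List (DecSetoid.Carrier D)) →
                  IsEnumeration (DecSetoid.setoid D) xs → FiniteSet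
fromEnumeration D xs xs-complete = record
  { decSetoid = D
  ; elements  = deduplicate (DecSetoid._≟_ D) xs
  ; complete  = Enumeratesₚ.deduplicate⁺ D xs-complete
  ; unique    = deduplicate-! D xs
  }

module _ (Ω : FiniteSet) where
  private module Ω = FiniteSet Ω

  vectors : ∀ m → List (Vec Ω.Carrier m)
  vectors zero    = [] ∷ []
  vectors (suc m) = cartesianProductWith _∷_ Ω.elements (vectors m)

  private
    vecSetoid : ℕ → Setoid 0ℓ 0ℓ
    vecSetoid = Pointwise.setoid Ω.setoid

  vectors-complete : ∀ m → IsEnumeration (vecSetoid m) (vectors m)
  vectors-complete zero    []       = here []
  vectors-complete (suc m) (x ∷ xs) =
    Membershipₚ.∈-cartesianProductWith⁺ Ω.setoid (vecSetoid m) (vecSetoid (suc m))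
      _∷_ (Ω.complete x) (vectors-complete m xs)

  vectors-unique : ∀ m → Unique (vecSetoid m) (vectors m)
  vectors-unique zero    = [] ∷ []
  vectors-unique (suc m) =
    Uniqueₚ.cartesianProductWith⁺ Ω.setoid (vecSetoid m) (vecSetoid (suc m))
      _∷_ (λ { (p ∷ ps) → p , ps }) Ω.unique (vectors-unique m)

_^ˢ_ : FiniteSet → ℕ → FiniteSet
Ω ^ˢ m = record
  { decSetoid = Pointwise.decSetoid (FiniteSet.decSetoid Ω) m
  ; elements  = vectors Ω m
  ; complete  = vectors-complete Ω m
  ; unique    = vectors-unique Ω m
  }

module _ (S : Setoid 0ℓ 0ℓ) where
  open Setoid S
  open Membership S using (_∈_)

  lookup-injective : ∀ {xs} → Unique S xs → ∀ i j → lookup xs i ≈ lookup xs j → i ≡ j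
  lookup-injective (_    ∷ _)  zero    zero    _ = ≡.refl
  lookup-injective (x≉xs ∷ _)  zero    (suc j) p =
    contradiction p (All.lookup x≉xs (Membership≡ₚ.∈-lookup j))
  lookup-injective (x≉xs ∷ _)  (suc i) zero    p =
    contradiction (sym p) (All.lookup x≉xs (Membership≡ₚ.∈-lookup i))
  lookup-injective (_    ∷ u)  (suc i) (suc j) p = ≡.cong suc (lookup-injective u i j p)

  unique⇒length≤ : ∀ {xs ys} → Unique S xs → (∀ {x} → x ∈ xs → x ∈ ys) → length xs ≤ length ys
  unique⇒length≤ {xs} {ys} xs! xs⊆ys = Fin.injective⇒≤ {f = f} λ {i} {j} fi≡fj →
    lookup-injective xs! i j
      (Membershipₚ.index-injective S (xs⊆ys (∈-lookup i)) (xs⊆ys (∈-lookup j)) fi≡fj)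
    where
    ∈-lookup : ∀ i → lookup xs i ∈ xs
    ∈-lookup i = Membershipₚ.∈-lookup S xs i
    f : Fin (length xs) → Fin (length ys)
    f i = index (xs⊆ys (∈-lookup i))

module _ (Ω : FiniteSet) where
  open FiniteSet Ω

  count-≤ : {P Q : Pred Carrier 0ℓ} (P? : U.Decidable P) (Q? : U.Decidable Q) →
            P Respects _≈_ → Q Respects _≈_ →
            (f : Carrier → Carrier) → (∀ {x y} → x ≈ y → f x ≈ f y) →
            (∀ {x y} → f x ≈ f y → x ≈ y) →
            (∀ {x} → P x → Q (f x)) → count P? ≤ count Q?
  count-≤ P? Q? P-resp Q-resp f f-cong f-inj P⇒Q∘f = begin
    length (filter P? elements)          ≡⟨ length-map f (filter P? elements) ⟨
    length (map f (filter P? elements))  ≤⟨ unique⇒length≤ setoid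
                                              (Uniqueₚ.map⁺ setoid setoid f-inj (Uniqueₚ.filter⁺ setoid P? unique))
                                              map⊆ ⟩
    length (filter Q? elements)          ∎
    where
    open ℕ.≤-Reasoning
    open Membership setoid using (_∈_)
    map⊆ : ∀ {y} → y ∈ map f (filter P? elements) → y ∈ filter Q? elements
    map⊆ y∈ with x , x∈ , y≈fx ← Membershipₚ.∈-map⁻ setoid setoid y∈ =
      Membershipₚ.∈-filter⁺ setoid Q? Q-resp (complete _)
        (Q-resp (sym y≈fx) (P⇒Q∘f (proj₂ (Membershipₚ.∈-filter⁻ setoid P? P-resp {xs = elements} x∈))))

-- A partition S of Ω × Ω is given by the equivalence relation _≋_ on Ω × Ω
-- whose classes are the elements of S.  The set S is thus the setoid of
-- pairs under _≋_, the class of s being `basis s`.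
record Partition (Ω : FiniteSet) : Set₁ where
  open FiniteSet Ω using (Carrier; setoid)

  Pair : Set
  Pair = Carrier × Carrier

  field
    _≋_              : Rel Pair 0ℓ
    isDecEquivalence : IsDecEquivalence _≋_
    ≈⇒≋              : ∀ {p q} → Setoid._≈_ (setoid ×ₛ setoid) p q → p ≋ q

  open IsDecEquivalence isDecEquivalence public
    using (isEquivalence) renaming (refl to ≋-refl; sym to ≋-sym; trans to ≋-trans; _≟_ to _≋?_)

  S : Setoid 0ℓ 0ℓ
  S = record { isEquivalence = isEquivalence }

  basis : Pair → Pred Pair 0ℓ
  basis s p = p ≋ s

  IsRelation : Pred Pair 0ℓ → Set₁
  IsRelation R = Σ[ I ∈ Set ] Σ[ s ∈ (I → Pair) ] R ≐ ⋃ I (basis ∘ s)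

  -- The class t is represented by a pair (α , β) in it; the value is
  -- ∣ α r ∩ β s* ∣ for that pair.
  intersectionNumber : (r s t : Pair) → ℕ
  intersectionNumber r s (α , β) =
    FiniteSet.count Ω (λ γ → ((α , γ) ≋? r) ×-dec ((γ , β) ≋? s))

module _ (Ω : FiniteSet) where
  open FiniteSet Ω using (Carrier; _≈_)

  𝟙 : Pred Carrier 0ℓ → Pred (Carrier × Carrier) 0ℓ
  𝟙 Γ (α , β) = Γ α × α ≈ β

  transpose : Pred (Carrier × Carrier) 0ℓ → Pred (Carrier × Carrier) 0ℓ
  transpose r (α , β) = r (β , α)

  singleton : Carrier × Carrier → Pred (Carrier × Carrier) 0ℓ
  singleton (α , β) (γ , δ) = γ ≈ α × δ ≈ β

record IsCoherent {Ω : FiniteSet} (P : Partition Ω) : Set₁ where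
  open Partition P
  field
    diagonal   : IsRelation (𝟙 Ω U.U)
    transposed : ∀ s → ∃[ t ] basis t ≐ transpose Ω (basis s)
    coherent   : ∀ r s {t t′} → t ≋ t′ → intersectionNumber r s t ≡ intersectionNumber r s t′

record CoherentConfiguration (Ω : FiniteSet) : Set₁ where
  field
    partition  : Partition Ω
    isCoherent : IsCoherent partition
  open Partition partition public
  open IsCoherent isCoherent public

  IsFiber : Pred (FiniteSet.Carrier Ω) 0ℓ → Set
  IsFiber Γ = ∃[ s ] 𝟙 Ω Γ ≐ basis s

  IsUnionOfFibers : Pred (FiniteSet.Carrier Ω) 0ℓ → Set₁
  IsUnionOfFibers Δ = Σ[ I ∈ Set ] Σ[ Γ ∈ (I → Pred (FiniteSet.Carrier Ω) 0ℓ) ]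
                      (∀ i → IsFiber (Γ i)) × Δ ≐ ⋃ I Γ

  IsComplete : Set
  IsComplete = ∀ s → ∃[ p ] basis s ≐ singleton Ω p

open CoherentConfiguration using (partition)

infix 4 _≼_

_≼_ : {Ω : FiniteSet} → Partition Ω → Partition Ω → Set₁
P ≼ Q = ∀ R → Partition.IsRelation P R → Partition.IsRelation Q R

IsSmallest : {Ω : FiniteSet} → (CoherentConfiguration Ω → Set₁) → CoherentConfiguration Ω → Set₁
IsSmallest 𝒫 X = 𝒫 X × (∀ Y → 𝒫 Y → partition X ≼ partition Y)

module _ {Ω : FiniteSet} (X : CoherentConfiguration Ω) where
  open FiniteSet Ω using (Carrier; setoid)

  -- Δ is listed without regard to order or repetition; `HasBaseOfCardinality`
  -- asks for distinct points so that `length` is the cardinality.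
  IsPointExtension : List Carrier → CoherentConfiguration Ω → Set₁
  IsPointExtension Δ = IsSmallest λ Y →
    partition X ≼ partition Y ×
    All (λ α → CoherentConfiguration.IsRelation Y (singleton Ω (α , α))) Δ

  IsBase : List Carrier → Set₁
  IsBase Δ = ∃[ Y ] IsPointExtension Δ Y × CoherentConfiguration.IsComplete Y

  HasBaseOfCardinality : ℕ → Set₁
  HasBaseOfCardinality n = ∃[ Δ ] Unique setoid Δ × length Δ ≡ n × IsBase Δ

  IsBaseNumber : ℕ → Set₁
  IsBaseNumber b = HasBaseOfCardinality b × (∀ n → HasBaseOfCardinality n → b ≤ n)

record AlgebraicIsomorphism {Ω Ω′ : FiniteSet}
  (X : CoherentConfiguration Ω) (X′ : CoherentConfiguration Ω′) : Set where
  private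
    module X  = CoherentConfiguration X
    module X′ = CoherentConfiguration X′
  field
    bijection : Bijection X.S X′.S

  open Bijection bijection public using (to)

  field
    preserves : ∀ r s t → X.intersectionNumber r s t ≡ X′.intersectionNumber (to r) (to s) (to t)

  extend : Pred X.Pair 0ℓ → Pred X′.Pair 0ℓ
  extend R = ⋃ (Σ[ s ∈ X.Pair ] X.basis s ⊆ R) λ (s , _) → X′.basis (to s)

open AlgebraicIsomorphism using (extend)

module _ {Ω Ω′ : FiniteSet} where
  private
    module Ω  = FiniteSet Ω
    module Ω′ = FiniteSet Ω′

  image : Bijection Ω.setoid Ω′.setoid → Pred (Ω.Carrier × Ω.Carrier) 0ℓ → Pred (Ω′.Carrier × Ω′.Carrier) 0ℓ
  image f R p′ = ∃₂ λ α β → R (α , β) × singleton Ω′ (Bijection.to f α , Bijection.to f β) p′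

  IsInduced : {X : CoherentConfiguration Ω} {X′ : CoherentConfiguration Ω′} →
              AlgebraicIsomorphism X X′ → Set
  IsInduced {X} {X′} φ = Σ[ f ∈ Bijection Ω.setoid Ω′.setoid ]
    (∀ s → image f (CoherentConfiguration.basis X s) ≐
           CoherentConfiguration.basis X′ (AlgebraicIsomorphism.to φ s))

Diag : (Ω : FiniteSet) (m : ℕ) → Pred (FiniteSet.Carrier (Ω ^ˢ m)) 0ℓ
Diag Ω m v = ∃[ α ] FiniteSet._≈_ (Ω ^ˢ m) v (replicate m α)

module _ {Ω : FiniteSet} (P : Partition Ω) where
  open Partition P

  -- s₁ × ⋯ × sₘ as a relation on Ωᵐ.
  product : ∀ {m} → Vec Pair m → Pred (FiniteSet.Carrier (Ω ^ˢ m) × FiniteSet.Carrier (Ω ^ˢ m)) 0ℓ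
  product s (α , β) = ∀ i → basis (Vec.lookup s i) (Vec.lookup α i , Vec.lookup β i)

  -- The class of (α , β) is the product of the classes of (αᵢ , βᵢ).
  power : ∀ m → Partition (Ω ^ˢ m)
  power m = record
    { _≋_ = λ (α , β) (α′ , β′) → ∀ i →
        (Vec.lookup α i , Vec.lookup β i) ≋ (Vec.lookup α′ i , Vec.lookup β′ i)
    ; isDecEquivalence = record
      { isEquivalence = record
        { refl  = λ i → ≋-refl
        ; sym   = λ p i → ≋-sym (p i)
        ; trans = λ p q i → ≋-trans (p i) (q i)
        }
      ; _≟_ = λ (α , β) (α′ , β′) → Fin.all? λ i →
          (Vec.lookup α i , Vec.lookup β i) ≋? (Vec.lookup α′ i , Vec.lookup β′ i)
      }
    ; ≈⇒≋ = λ (p , q) i → ≈⇒≋ (Pointwise.lookup p i , Pointwise.lookup q i)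
    }

module _ (m : ℕ) where

  IsExtension : {Ω : FiniteSet} → CoherentConfiguration Ω → CoherentConfiguration (Ω ^ˢ m) → Set₁
  IsExtension {Ω} X = IsSmallest λ Y →
    power (partition X) m ≼ partition Y ×
    CoherentConfiguration.IsUnionOfFibers Y (Diag Ω m)

  IsDimensional : {Ω Ω′ : FiniteSet} {X : CoherentConfiguration Ω} {X′ : CoherentConfiguration Ω′} →
                  AlgebraicIsomorphism X X′ → Set₁
  IsDimensional {Ω} {Ω′} {X} {X′} φ =
    ∃₂ λ Y Y′ → IsExtension X Y × IsExtension X′ Y′ ×
    Σ[ ψ ∈ AlgebraicIsomorphism Y Y′ ]
      extend ψ (𝟙 (Ω ^ˢ m) (Diag Ω m)) ≐ 𝟙 (Ω′ ^ˢ m) (Diag Ω′ m) ×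
      (∀ (s : Vec (CoherentConfiguration.Pair X) m) →
         extend ψ (product (partition X) s) ≐
         product (partition X′) (Vec.map (AlgebraicIsomorphism.to φ) s))

  IsSeparable : {Ω : FiniteSet} → CoherentConfiguration Ω → Set₁
  IsSeparable X = ∀ {Ω′} (X′ : CoherentConfiguration Ω′) (φ : AlgebraicIsomorphism X X′) →
                  IsDimensional φ → IsInduced φ

-- `elements` may list an element more than once.
record FiniteGroup : Set₁ where
  field
    group       : Group 0ℓ 0ℓ
  open Group group public
  field
    _≟_         : Decidable _≈_
    elements    : List Carrier
    enumeration : IsEnumeration setoid elements

record RightAction (G : FiniteGroup) (Ω : FiniteSet) : Set where
  private
    module G = FiniteGroup G
    module Ω = FiniteSet Ω
  infixl 7 _·_
  field
    _·_        : Ω.Carrier → G.Carrier → Ω.Carrier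
    ·-cong     : ∀ {α β g h} → α Ω.≈ β → g G.≈ h → α · g Ω.≈ β · h
    ·-identity : ∀ α → α · G.ε Ω.≈ α
    ·-assoc    : ∀ α g h → α · g · h Ω.≈ α · (g G.∙ h)

-- Classes of _∼_ are the orbits of G on Ω × Ω.
module Inv {G : FiniteGroup} {Ω : FiniteSet} (act : RightAction G Ω) where
  private
    module G = FiniteGroup G
    module Ω = FiniteSet Ω
  open RightAction act

  _∼_ : Rel (Ω.Carrier × Ω.Carrier) 0ℓ
  (α , β) ∼ (γ , δ) = ∃[ g ] (α · g Ω.≈ γ × β · g Ω.≈ δ)

  cancel : ∀ {g h} → g G.∙ h G.≈ G.ε → ∀ {α β} → α · g Ω.≈ β → β · h Ω.≈ α
  cancel {g} {h} gh≈ε {α} {β} p =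
    Ω.trans (·-cong (Ω.sym p) G.refl)
      (Ω.trans (·-assoc α g h) (Ω.trans (·-cong Ω.refl gh≈ε) (·-identity α)))

  undo : ∀ {α β} g → α · g Ω.≈ β → β · (g G.⁻¹) Ω.≈ α
  undo g = cancel (G.inverseʳ g)

  compose : ∀ {α β γ} g h → α · g Ω.≈ β → β · h Ω.≈ γ → α · (g G.∙ h) Ω.≈ γ
  compose {α} g h p q = Ω.trans (Ω.sym (·-assoc α g h)) (Ω.trans (·-cong p G.refl) q)

  ∼-refl : ∀ {p} → p ∼ p
  ∼-refl = G.ε , ·-identity _ , ·-identity _

  ∼-sym : ∀ {p q} → p ∼ q → q ∼ p
  ∼-sym (g , p , q) = g G.⁻¹ , undo g p , undo g q

  ∼-trans : ∀ {p q r} → p ∼ q → q ∼ r → p ∼ r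
  ∼-trans (g , p , q) (h , p′ , q′) = g G.∙ h , compose g h p p′ , compose g h q q′

  ≈⇒∼ : ∀ {α β γ δ} → α Ω.≈ γ → β Ω.≈ δ → (α , β) ∼ (γ , δ)
  ≈⇒∼ p q = G.ε , Ω.trans (·-identity _) p , Ω.trans (·-identity _) q

  _∼?_ : Decidable _∼_
  (α , β) ∼? (γ , δ) = map′ Any.satisfied
    (λ (g , p , q) → Any.map
      (λ g≈h → Ω.trans (·-cong Ω.refl (G.sym g≈h)) p , Ω.trans (·-cong Ω.refl (G.sym g≈h)) q)
      (G.enumeration g))
    (Any.any? (λ g → ((α · g) Ω.≟ γ) ×-dec ((β · g) Ω.≟ δ)) G.elements)

  orbits : Partition Ω
  orbits = record
    { _≋_              = _∼_
    ; isDecEquivalence = record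
      { isEquivalence = record { refl = ∼-refl ; sym = ∼-sym ; trans = ∼-trans }
      ; _≟_           = _∼?_
      }
    ; ≈⇒≋              = λ (p , q) → ≈⇒∼ p q
    }

  private
    open Partition orbits using (Pair; basis; intersectionNumber)

    intersection-≤ : ∀ (r s : Pair) {t t′} → t ∼ t′ → intersectionNumber r s t ≤ intersectionNumber r s t′
    intersection-≤ r s {α , β} {α′ , β′} (g , αg≈α′ , βg≈β′) =
      count-≤ Ω (λ γ → ((α  , γ) ∼? r) ×-dec ((γ , β)  ∼? s))
                (λ γ → ((α′ , γ) ∼? r) ×-dec ((γ , β′) ∼? s))
        respects respects (_· g) (λ p → ·-cong p G.refl)
        (λ p → Ω.trans (Ω.sym (undo g p)) (undo g Ω.refl))
        (λ (p , q) → ∼-trans (∼-sym (g , αg≈α′ , Ω.refl)) p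
                   , ∼-trans (∼-sym (g , Ω.refl , βg≈β′)) q)
      where
      respects : ∀ {α β γ γ′} → γ Ω.≈ γ′ → (α , γ) ∼ r × (γ , β) ∼ s → (α , γ′) ∼ r × (γ′ , β) ∼ s
      respects e (p , q) = ∼-trans (≈⇒∼ Ω.refl (Ω.sym e)) p , ∼-trans (≈⇒∼ (Ω.sym e) Ω.refl) q

  isCoherent : IsCoherent orbits
  isCoherent = record
    { diagonal   = Ω.Carrier , (λ α → α , α)
                 , (λ { {α , β} (_ , α≈β) → α , ≈⇒∼ Ω.refl (Ω.sym α≈β) })
                 , (λ { {α , β} (γ , g , p , q) → _ ,
                        Ω.trans (Ω.sym (undo g p))
                          (Ω.trans (·-cong (Ω.refl {γ}) G.refl) (undo g q)) })
    ; transposed = λ (α , β) → (β , α) , (λ (g , p , q) → g , q , p) , (λ (g , p , q) → g , q , p)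
    ; coherent   = λ r s t∼t′ →
        ℕ.≤-antisym (intersection-≤ r s t∼t′) (intersection-≤ r s (∼-sym t∼t′))
    }

  scheme : CoherentConfiguration Ω
  scheme = record { partition = orbits ; isCoherent = isCoherent }

record Subgroup (G : FiniteGroup) : Set₁ where
  open FiniteGroup G
  field
    _∈H      : Pred Carrier 0ℓ
    _∈H?     : U.Decidable _∈H
    resp     : _∈H Respects _≈_
    ε-closed : ε ∈H
    ∙-closed : ∀ {x y} → x ∈H → y ∈H → (x ∙ y) ∈H
    ⁻¹-closed : ∀ {x} → x ∈H → (x ⁻¹) ∈H

module _ {G : FiniteGroup} (H : Subgroup G) where
  open FiniteGroup G
  open Subgroup H
  open GroupProperties group using (⁻¹-anti-homo-∙; ⁻¹-involutive)

  -- Elements of G represent their cosets: x ≈ᴴ y means Hx = Hy.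
  _≈ᴴ_ : Rel Carrier 0ℓ
  x ≈ᴴ y = (x ∙ y ⁻¹) ∈H

  cancel-middle : ∀ x y z w → y ∙ z ≈ ε → (x ∙ y) ∙ (z ∙ w) ≈ x ∙ w
  cancel-middle x y z w yz≈ε = begin
    (x ∙ y) ∙ (z ∙ w)  ≈⟨ assoc x y (z ∙ w) ⟩
    x ∙ (y ∙ (z ∙ w))  ≈⟨ ∙-congˡ (assoc y z w) ⟨
    x ∙ ((y ∙ z) ∙ w)  ≈⟨ ∙-congˡ (∙-congʳ yz≈ε) ⟩
    x ∙ (ε ∙ w)        ≈⟨ ∙-congˡ (identityˡ w) ⟩
    x ∙ w              ∎
    where open SetoidReasoning setoid

  ≈⇒≈ᴴ : ∀ {x y} → x ≈ y → x ≈ᴴ y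
  ≈⇒≈ᴴ {x} {y} x≈y = resp (trans (sym (inverseʳ y)) (∙-congʳ (sym x≈y))) ε-closed

  ≈ᴴ-sym : ∀ {x y} → x ≈ᴴ y → y ≈ᴴ x
  ≈ᴴ-sym {x} {y} p = resp (trans (⁻¹-anti-homo-∙ x (y ⁻¹)) (∙-congʳ (⁻¹-involutive y))) (⁻¹-closed p)

  ≈ᴴ-trans : ∀ {x y z} → x ≈ᴴ y → y ≈ᴴ z → x ≈ᴴ z
  ≈ᴴ-trans {x} {y} {z} p q = resp (cancel-middle x (y ⁻¹) y (z ⁻¹) (inverseˡ y)) (∙-closed p q)

  ≈ᴴ-∙ : ∀ {x y} g → x ≈ᴴ y → (x ∙ g) ≈ᴴ (y ∙ g)
  ≈ᴴ-∙ {x} {y} g p = resp (sym (trans (∙-congˡ (⁻¹-anti-homo-∙ y g))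
                                     (cancel-middle x g (g ⁻¹) (y ⁻¹) (inverseʳ g)))) p

  rightCosets : FiniteSet
  rightCosets = fromEnumeration
    (record
      { Carrier          = Carrier
      ; _≈_              = _≈ᴴ_
      ; isDecEquivalence = record
        { isEquivalence = record { refl = ≈⇒≈ᴴ refl ; sym = ≈ᴴ-sym ; trans = ≈ᴴ-trans }
        ; _≟_           = λ x y → (x ∙ y ⁻¹) ∈H?
        }
      })
    elements (λ x → Any.map ≈⇒≈ᴴ (enumeration x))

  rightMultiplication : RightAction G rightCosets
  rightMultiplication = record
    { _·_        = _∙_
    ; ·-cong     = λ {_} {β} {g} p g≈h → ≈ᴴ-trans (≈ᴴ-∙ g p) (≈⇒≈ᴴ (∙-congˡ g≈h))
    ; ·-identity = λ α → ≈⇒≈ᴴ (identityʳ α)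
    ; ·-assoc    = λ α g h → ≈⇒≈ᴴ (assoc α g h)
    }

IsPrimePower : ℕ → Set
IsPrimePower q = ∃₂ λ p k → Prime p × k ≥ 1 × q ≡ p ^ k

record FieldOfOrder (q : ℕ) : Set₁ where
  field
    commutativeRing : CommutativeRing 0ℓ 0ℓ
  open CommutativeRing commutativeRing public
  field
    1≉0          : ¬ 1# ≈ 0#
    invertible   : ∀ x → ¬ x ≈ 0# → ∃[ y ] x * y ≈ 1#
    finite       : Inverse setoid (≡.setoid (Fin q))

module _ {q : ℕ} (F : FieldOfOrder q) where
  open FieldOfOrder F
  open RingProperties ring using (-‿distribˡ-*; -‿distribʳ-*)
  open AbelianGroupProperties +-abelianGroup
    using (⁻¹-involutive; ∙-cancelʳ; ⁻¹-∙-comm; ε⁻¹≈ε)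
  open SetoidReasoning setoid

  record SL₂ : Set where
    constructor mat
    field
      a b c d : Carrier
      det     : a * d - b * c ≈ 1#

  open SL₂

  module Solver = NaturalSolver commutativeSemiring
  open Solver using (_:+_; _:*_; _:=_)

  det⁺ : ∀ {x y} → x - y ≈ 1# → x ≈ 1# + y
  det⁺ {x} {y} p = begin
    x              ≈⟨ +-identityʳ x ⟨
    x + 0#         ≈⟨ +-congˡ (-‿inverseˡ y) ⟨
    x + (- y + y)  ≈⟨ +-assoc x (- y) y ⟨
    (x - y) + y    ≈⟨ +-congʳ p ⟩
    1# + y         ∎

  det⁻ : ∀ {x y} → x ≈ 1# + y → x - y ≈ 1#
  det⁻ {x} {y} p = begin
    x - y            ≈⟨ +-congʳ p ⟩
    (1# + y) - y     ≈⟨ +-assoc 1# y (- y) ⟩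
    1# + (y - y)     ≈⟨ +-congˡ (-‿inverseʳ y) ⟩
    1# + 0#          ≈⟨ +-identityʳ 1# ⟩
    1#               ∎

  -x*-y : ∀ x y → - x * - y ≈ x * y
  -x*-y x y = begin
    - x * - y    ≈⟨ -‿distribˡ-* x (- y) ⟨
    - (x * - y)  ≈⟨ -‿cong (-‿distribʳ-* x y) ⟨
    - - (x * y)  ≈⟨ ⁻¹-involutive (x * y) ⟩
    x * y        ∎

  det-neg : ∀ w x y z → w * x - y * z ≈ 1# → - w * - x - - y * - z ≈ 1#
  det-neg w x y z = trans (+-cong (-x*-y w x) (-‿cong (-x*-y y z)))

  det-∙ : ∀ a b c d a′ b′ c′ d′ → a * d - b * c ≈ 1# → a′ * d′ - b′ * c′ ≈ 1# →
          (a * a′ + b * c′) * (c * b′ + d * d′) - (a * b′ + b * d′) * (c * a′ + d * c′) ≈ 1#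
  det-∙ a b c d a′ b′ c′ d′ p p′ = det⁻ (∙-cancelʳ X P (1# + Q) (begin
    P + X
      ≈⟨ solve 8 (λ a b c d a′ b′ c′ d′ →
           (a :* a′ :+ b :* c′) :* (c :* b′ :+ d :* d′) :+ (a :* d :* (b′ :* c′) :+ b :* c :* (a′ :* d′)) :=
           (a :* b′ :+ b :* d′) :* (c :* a′ :+ d :* c′) :+ (a :* d :* (a′ :* d′) :+ b :* c :* (b′ :* c′)))
           refl a b c d a′ b′ c′ d′ ⟩
    Q + (a * d * (a′ * d′) + u * v)
      ≈⟨ +-congˡ (+-congʳ (*-cong (det⁺ p) (det⁺ p′))) ⟩
    Q + ((1# + u) * (1# + v) + u * v)
      ≈⟨ solve 3 (λ Q u v → Q :+ ((con 1 :+ u) :* (con 1 :+ v) :+ u :* v) :=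
                            con 1 :+ Q :+ ((con 1 :+ u) :* v :+ u :* (con 1 :+ v)))
           refl Q u v ⟩
    1# + Q + ((1# + u) * v + u * (1# + v))
      ≈⟨ +-congˡ (+-cong (*-congʳ (det⁺ p)) (*-congˡ (det⁺ p′))) ⟨
    1# + Q + X ∎))
    where
    open Solver using (solve; con)
    u = b * c
    v = b′ * c′
    P = (a * a′ + b * c′) * (c * b′ + d * d′)
    Q = (a * b′ + b * d′) * (c * a′ + d * c′)
    X = a * d * v + u * (a′ * d′)

  entry-assoc : ∀ x y a b c d z w →
                (x * a + y * c) * z + (x * b + y * d) * w ≈ x * (a * z + b * w) + y * (c * z + d * w)
  entry-assoc = solve 8 (λ x y a b c d z w →
      (x :* a :+ y :* c) :* z :+ (x :* b :+ y :* d) :* w :=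
      x :* (a :* z :+ b :* w) :+ y :* (c :* z :+ d :* w)) refl
    where open Solver using (solve)

  entry-neg : ∀ x y z w → - x * z + - y * w ≈ - (x * z + y * w)
  entry-neg x y z w = trans (+-cong (sym (-‿distribˡ-* x z)) (sym (-‿distribˡ-* y w)))
                            (⁻¹-∙-comm (x * z) (y * w))

  entry-neg′ : ∀ x y z w → x * - z + y * - w ≈ - (x * z + y * w)
  entry-neg′ x y z w = trans (+-cong (sym (-‿distribʳ-* x z)) (sym (-‿distribʳ-* y w)))
                             (⁻¹-∙-comm (x * z) (y * w))

  1x+0y : ∀ x y → 1# * x + 0# * y ≈ x
  1x+0y x y = trans (+-cong (*-identityˡ x) (zeroˡ y)) (+-identityʳ x)

  0x+1y : ∀ x y → 0# * x + 1# * y ≈ y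
  0x+1y x y = trans (+-cong (zeroˡ x) (*-identityˡ y)) (+-identityˡ y)

  x1+y0 : ∀ x y → x * 1# + y * 0# ≈ x
  x1+y0 x y = trans (+-cong (*-identityʳ x) (zeroʳ y)) (+-identityʳ x)

  x0+y1 : ∀ x y → x * 0# + y * 1# ≈ y
  x0+y1 x y = trans (+-cong (zeroʳ x) (*-identityʳ y)) (+-identityˡ y)

  infix 4 _≈ᴹ_ _≈±_
  infixl 7 _∙_

  _≈ᴹ_ : Rel SL₂ 0ℓ
  M ≈ᴹ N = a M ≈ a N × b M ≈ b N × c M ≈ c N × d M ≈ d N

  _∙_ : SL₂ → SL₂ → SL₂
  mat a b c d p ∙ mat a′ b′ c′ d′ p′ =
    mat (a * a′ + b * c′) (a * b′ + b * d′)
        (c * a′ + d * c′) (c * b′ + d * d′) (det-∙ a b c d a′ b′ c′ d′ p p′)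

  I : SL₂
  I = mat 1# 0# 0# 1# (det⁻ (trans (*-identityʳ 1#)
                               (sym (trans (+-congˡ (zeroˡ 0#)) (+-identityʳ 1#)))))

  inv : SL₂ → SL₂
  inv (mat a b c d p) = mat d (- b) (- c) a
    (trans (+-cong (*-comm d a) (-‿cong (-x*-y b c))) p)

  neg : SL₂ → SL₂
  neg (mat a b c d p) = mat (- a) (- b) (- c) (- d) (det-neg a d b c p)

  _≈±_ : Rel SL₂ 0ℓ
  M ≈± N = M ≈ᴹ N ⊎ M ≈ᴹ neg N

  ≈ᴹ-refl : ∀ {M} → M ≈ᴹ M
  ≈ᴹ-refl = refl , refl , refl , refl

  ≈ᴹ-sym : ∀ {M N} → M ≈ᴹ N → N ≈ᴹ M
  ≈ᴹ-sym (p , q , r , s) = sym p , sym q , sym r , sym s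

  ≈ᴹ-trans : ∀ {M N K} → M ≈ᴹ N → N ≈ᴹ K → M ≈ᴹ K
  ≈ᴹ-trans (p , q , r , s) (p′ , q′ , r′ , s′) = trans p p′ , trans q q′ , trans r r′ , trans s s′

  neg-cong : ∀ {M N} → M ≈ᴹ N → neg M ≈ᴹ neg N
  neg-cong (p , q , r , s) = -‿cong p , -‿cong q , -‿cong r , -‿cong s

  neg-neg : ∀ M → neg (neg M) ≈ᴹ M
  neg-neg M = ⁻¹-involutive _ , ⁻¹-involutive _ , ⁻¹-involutive _ , ⁻¹-involutive _

  ∙-congᴹ : ∀ {M M′ N N′} → M ≈ᴹ M′ → N ≈ᴹ N′ → M ∙ N ≈ᴹ M′ ∙ N′
  ∙-congᴹ (p , q , r , s) (p′ , q′ , r′ , s′) =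
      +-cong (*-cong p p′) (*-cong q r′) , +-cong (*-cong p q′) (*-cong q s′)
    , +-cong (*-cong r p′) (*-cong s r′) , +-cong (*-cong r q′) (*-cong s s′)

  neg-∙ˡ : ∀ M N → neg M ∙ N ≈ᴹ neg (M ∙ N)
  neg-∙ˡ M N = entry-neg _ _ _ _ , entry-neg _ _ _ _ , entry-neg _ _ _ _ , entry-neg _ _ _ _

  neg-∙ʳ : ∀ M N → M ∙ neg N ≈ᴹ neg (M ∙ N)
  neg-∙ʳ M N = entry-neg′ _ _ _ _ , entry-neg′ _ _ _ _ , entry-neg′ _ _ _ _ , entry-neg′ _ _ _ _

  ≈±-sym : ∀ {M N} → M ≈± N → N ≈± M
  ≈±-sym {M} {N} (inj₁ p) = inj₁ (≈ᴹ-sym {M} {N} p)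
  ≈±-sym {M} {N} (inj₂ p) = inj₂ (≈ᴹ-sym {neg M} {N} (≈ᴹ-trans {neg M} {neg (neg N)} {N} (neg-cong {M} {neg N} p) (neg-neg N)))

  ≈±-trans : ∀ {M N K} → M ≈± N → N ≈± K → M ≈± K
  ≈±-trans {M} {N} {K} (inj₁ p) (inj₁ q) = inj₁ (≈ᴹ-trans {M} {N} {K} p q)
  ≈±-trans {M} {N} {K} (inj₁ p) (inj₂ q) = inj₂ (≈ᴹ-trans {M} {N} {neg K} p q)
  ≈±-trans {M} {N} {K} (inj₂ p) (inj₁ q) = inj₂ (≈ᴹ-trans {M} {neg N} {neg K} p (neg-cong {N} {K} q))
  ≈±-trans {M} {N} {K} (inj₂ p) (inj₂ q) =
    inj₁ (≈ᴹ-trans {M} {neg N} {K} p (≈ᴹ-trans {neg N} {neg (neg K)} {K} (neg-cong {N} {neg K} q) (neg-neg K)))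

  ∙-cong± : ∀ {M M′ N N′} → M ≈± M′ → N ≈± N′ → M ∙ N ≈± M′ ∙ N′
  ∙-cong± {M} {M′} {N} {N′} (inj₁ p) (inj₁ q) = inj₁ (∙-congᴹ {M} {M′} {N} {N′} p q)
  ∙-cong± {M} {M′} {N} {N′} (inj₁ p) (inj₂ q) =
    inj₂ (≈ᴹ-trans {M ∙ N} {M′ ∙ neg N′} {neg (M′ ∙ N′)} (∙-congᴹ {M} {M′} {N} {neg N′} p q) (neg-∙ʳ M′ N′))
  ∙-cong± {M} {M′} {N} {N′} (inj₂ p) (inj₁ q) =
    inj₂ (≈ᴹ-trans {M ∙ N} {neg M′ ∙ N′} {neg (M′ ∙ N′)} (∙-congᴹ {M} {neg M′} {N} {N′} p q) (neg-∙ˡ M′ N′))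
  ∙-cong± {M} {M′} {N} {N′} (inj₂ p) (inj₂ q) =
    inj₁ (≈ᴹ-trans {M ∙ N} {neg M′ ∙ neg N′} {M′ ∙ N′} (∙-congᴹ {M} {neg M′} {N} {neg N′} p q)
           (≈ᴹ-trans {neg M′ ∙ neg N′} {neg (neg M′ ∙ N′)} {M′ ∙ N′} (neg-∙ʳ (neg M′) N′)
             (≈ᴹ-trans {neg (neg M′ ∙ N′)} {neg (neg (M′ ∙ N′))} {M′ ∙ N′}
               (neg-cong {neg M′ ∙ N′} {neg (M′ ∙ N′)} (neg-∙ˡ M′ N′)) (neg-neg (M′ ∙ N′)))))

  inv-cong± : ∀ {M N} → M ≈± N → inv M ≈± inv N
  inv-cong± (inj₁ (p , q , r , s)) = inj₁ (s , -‿cong q , -‿cong r , p)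
  inv-cong± (inj₂ (p , q , r , s)) = inj₂ (s , -‿cong q , -‿cong r , p)

  ∙-assoc : ∀ M N K → (M ∙ N) ∙ K ≈ᴹ M ∙ (N ∙ K)
  ∙-assoc M N K = entry-assoc _ _ _ _ _ _ _ _ , entry-assoc _ _ _ _ _ _ _ _
                , entry-assoc _ _ _ _ _ _ _ _ , entry-assoc _ _ _ _ _ _ _ _

  invˡ : ∀ M → inv M ∙ M ≈ᴹ I
  invˡ (mat a b c d p) =
      trans (+-cong (*-comm d a) (sym (-‿distribˡ-* b c))) p
    , trans (+-cong (*-comm d b) (sym (-‿distribˡ-* b d))) (-‿inverseʳ (b * d))
    , trans (+-cong (trans (sym (-‿distribˡ-* c a)) (-‿cong (*-comm c a))) refl) (-‿inverseˡ (a * c))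
    , trans (+-cong (trans (sym (-‿distribˡ-* c b)) (-‿cong (*-comm c b))) refl) (trans (+-comm _ _) p)

  invʳ : ∀ M → M ∙ inv M ≈ᴹ I
  invʳ (mat a b c d p) =
      trans (+-congˡ (sym (-‿distribʳ-* b c))) p
    , trans (+-cong (trans (sym (-‿distribʳ-* a b)) (-‿cong (*-comm a b))) refl) (-‿inverseˡ (b * a))
    , trans (+-cong (*-comm c d) (sym (-‿distribʳ-* d c))) (-‿inverseʳ (d * c))
    , trans (+-cong (trans (sym (-‿distribʳ-* c b)) (-‿cong (*-comm c b))) (*-comm d a)) (trans (+-comm _ _) p)

  _≟ᶠ_ : Decidable _≈_
  x ≟ᶠ y = map′
    (λ p → trans (sym (inverseʳ′ x)) (trans (from-cong p) (inverseʳ′ y)))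
    to-cong (to x Fin.≟ to y)
    where
    open Inverse finite using (to; from; to-cong; from-cong)
    inverseʳ′ = Inverse.strictlyInverseʳ finite

  _≟ᴹ_ : Decidable _≈ᴹ_
  M ≟ᴹ N = (a M ≟ᶠ a N) ×-dec (b M ≟ᶠ b N) ×-dec (c M ≟ᶠ c N) ×-dec (d M ≟ᶠ d N)

  _≟±_ : Decidable _≈±_
  M ≟± N = (M ≟ᴹ N) ⊎-dec (M ≟ᴹ neg N)

  fieldElements : List Carrier
  fieldElements = map (Inverse.from finite) (allFin q)

  fieldElements-complete : IsEnumeration setoid fieldElements
  fieldElements-complete x = Membershipₚ.∈-resp-≈ setoid (Inverse.strictlyInverseʳ finite x)
    (Membershipₚ.∈-map⁺ (≡.setoid (Fin q)) setoid (Inverse.from-cong finite)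
      (Membership≡ₚ.∈-allFin (Inverse.to finite x)))

  Quadruple : Setoid 0ℓ 0ℓ
  Quadruple = setoid ×ₛ (setoid ×ₛ (setoid ×ₛ setoid))

  quadruples : List (Setoid.Carrier Quadruple)
  quadruples = cartesianProduct fieldElements
    (cartesianProduct fieldElements (cartesianProduct fieldElements fieldElements))

  quadruples-complete : IsEnumeration Quadruple quadruples
  quadruples-complete =
    Enumeratesₚ.cartesianProduct⁺ setoid (setoid ×ₛ (setoid ×ₛ setoid)) fieldElements-complete
      (Enumeratesₚ.cartesianProduct⁺ setoid (setoid ×ₛ setoid) fieldElements-complete
        (Enumeratesₚ.cartesianProduct⁺ setoid setoid fieldElements-complete fieldElements-complete))

  matrices : List (Setoid.Carrier Quadruple) → List SL₂
  matrices []                       = []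
  matrices ((a , b , c , d) ∷ qs) with (a * d - b * c) ≟ᶠ 1#
  ... | yes p = mat a b c d p ∷ matrices qs
  ... | no  _ = matrices qs

  matrices-complete : ∀ M qs → Any (Setoid._≈_ Quadruple (a M , b M , c M , d M)) qs →
                      Any (M ≈ᴹ_) (matrices qs)
  matrices-complete M ((a′ , b′ , c′ , d′) ∷ qs) M∈ with (a′ * d′ - b′ * c′) ≟ᶠ 1# | M∈
  ... | yes _  | here M≈  = here M≈
  ... | yes _  | there M∈ = there (matrices-complete M qs M∈)
  ... | no  ¬p | here (p , q , r , s) =
    contradiction (trans (+-cong (*-cong (sym p) (sym s)) (-‿cong (*-cong (sym q) (sym r)))) (det M)) ¬p
  ... | no  _  | there M∈ = matrices-complete M qs M∈

  -- SL(2,q) modulo {I , -I}: equality is equality of matrices up to sign.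
  PSL₂ : FiniteGroup
  PSL₂ = record
    { group       = record
      { Carrier = SL₂
      ; _≈_     = _≈±_
      ; _∙_     = _∙_
      ; ε       = I
      ; _⁻¹     = inv
      ; isGroup = record
        { isMonoid = record
          { isSemigroup = record
            { isMagma = record
              { isEquivalence = record
                { refl  = λ {M} → inj₁ (≈ᴹ-refl {M})
                ; sym   = λ {M} {N} → ≈±-sym {M} {N}
                ; trans = λ {M} {N} {K} → ≈±-trans {M} {N} {K}
                }
              ; ∙-cong = λ {M} {M′} {N} {N′} → ∙-cong± {M} {M′} {N} {N′}
              }
            ; assoc = λ M N K → inj₁ (∙-assoc M N K)
            }
          ; identity = (λ M → inj₁ (1x+0y _ _ , 1x+0y _ _ , 0x+1y _ _ , 0x+1y _ _))
                     , (λ M → inj₁ (x1+y0 _ _ , x0+y1 _ _ , x1+y0 _ _ , x0+y1 _ _))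
          }
        ; inverse = (λ M → inj₁ (invˡ M)) , (λ M → inj₁ (invʳ M))
        ; ⁻¹-cong = λ {M} {N} → inv-cong± {M} {N}
        }
      }
    ; _≟_         = _≟±_
    ; elements    = matrices quadruples
    ; enumeration = λ M → Any.map inj₁ (matrices-complete M quadruples (quadruples-complete _))
    }

  IsDiagonal : Pred SL₂ 0ℓ
  IsDiagonal M = b M ≈ 0# × c M ≈ 0#

  -- D is taken in SL(2,q) and ≈± is equality in PSL(2,q), so this is the image
  -- of the diagonal subgroup.
  InCartan : Pred SL₂ 0ℓ
  InCartan M = ∃[ D ] IsDiagonal D × M ≈± D

  -0≈0 : ∀ {x} → x ≈ 0# → - x ≈ 0#
  -0≈0 p = trans (-‿cong p) ε⁻¹≈ε

  +-zero : ∀ {x y z w} → y ≈ 0# → z ≈ 0# → x * y + z * w ≈ 0#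
  +-zero p q = trans (+-cong (trans (*-congˡ p) (zeroʳ _)) (trans (*-congʳ q) (zeroˡ _))) (+-identityˡ 0#)

  diagonal-∙ : ∀ M N → IsDiagonal M → IsDiagonal N → IsDiagonal (M ∙ N)
  diagonal-∙ M N (p , q) (p′ , q′) = +-zero p′ p , trans (+-comm _ _) (+-zero q′ q)

  inCartan⇒diagonal : ∀ M → InCartan M → IsDiagonal M
  inCartan⇒diagonal M (D , (p , q) , inj₁ (_ , r , s , _)) = trans r p , trans s q
  inCartan⇒diagonal M (D , (p , q) , inj₂ (_ , r , s , _)) = trans r (-0≈0 p) , trans s (-0≈0 q)

  Cartan : Subgroup PSL₂
  Cartan = record
    { _∈H       = InCartan
    ; _∈H?      = λ M → map′ (λ p → M , p , G.refl {M}) (inCartan⇒diagonal M)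
                        ((b M ≟ᶠ 0#) ×-dec (c M ≟ᶠ 0#))
    ; resp      = λ {M} {N} M≈N (D , p , q) → D , p , G.trans {N} {M} {D} (G.sym {M} {N} M≈N) q
    ; ε-closed  = I , (refl , refl) , G.refl {I}
    ; ∙-closed  = λ {M} {N} (D , p , q) (E , p′ , q′) →
                    D ∙ E , diagonal-∙ D E p p′ , G.∙-cong {M} {D} {N} {E} q q′
    ; ⁻¹-closed = λ {M} (D , (p , p′) , q) → inv D , (-0≈0 p , -0≈0 p′) , G.⁻¹-cong {M} {D} q
    }
    where module G = FiniteGroup PSL₂

  cartanScheme : CoherentConfiguration (rightCosets Cartan)
  cartanScheme = Inv.scheme (rightMultiplication Cartan)

{-# OPTIONS --safe #-}

-- A coset of H is an ordered pair (x , y) of distinct points of the projective line, the points of the two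
-- rows of a representing matrix.  Put α = ((1 : 0) , (0 : 1)) and β = ((1 : 0) , (-1 : 1)).  If neither x
-- nor y is (1 : 0), the basis relations of (α , γ) and (β , γ) determine γ = (x , y), because they determine
-- the products ad, bc and bd of matrix entries.  If x is (1 : 0), then α determines x, and y is a point of
-- some pair without (1 : 0), which is already determined; similarly for y.  Hence any refinement of the scheme
-- in which α and β are fixed separates all points.  Applied to a configuration fixing α and β this makes
-- {α , β} a base.  Applied to the 2-extension it says that γ is determined by the basis relation of
-- ((α , β) , (γ , γ)), so an algebraic isomorphism of 2-extensions can be read as a map of points: choose an
-- image (α′ , β′) of (α , β) and send γ to the γ′ such that ((α′ , β′) , (γ′ , γ′)) is in the image of that
-- relation.  No smaller base exists since the stabilizer of a point, a conjugate of H, is nontrivial for q > 3.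
module Submission where

open import Defs
open import Algebra.Bundles using (Group)
import Algebra.Construct.Terminal as Terminal
import Algebra.Properties.Group as GroupProperties
import Algebra.Properties.Ring as RingProperties
open import Data.Fin.Base using (Fin)
open import Data.Fin.Patterns using (0F; 1F; 2F)
import Data.Fin.Properties as Fin
open import Data.List.Base using (List; []; _∷_; filter; length)
open import Data.List.Properties using (filter-some)
open import Data.List.Relation.Unary.All as All using (All; []; _∷_)
open import Data.List.Relation.Unary.AllPairs using ([]; _∷_)
open import Data.List.Relation.Unary.Any as Any using (Any; here; there)
open import Data.Nat.Base using (ℕ; _>_; _<_; z≤n; s≤s)
open import Data.Product.Base using (Σ-syntax; ∃-syntax; _×_; _,_; proj₁; proj₂)
open import Data.Sum.Base using (_⊎_; inj₁; inj₂)
open import Data.Vec.Base using (Vec; []; _∷_; replicate)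
open import Data.Vec.Relation.Binary.Pointwise.Inductive as Pointwise using ([]; _∷_)
open import Function.Base using (_∘_)
open import Function.Bundles using (Bijection; Inverse)
open import Level using (0ℓ)
open import Relation.Binary.Core using (Rel)
open import Relation.Binary.PropositionalEquality.Core as ≡ using (_≡_)
import Relation.Binary.Reasoning.Setoid as SetoidReasoning
open import Relation.Nullary.Decidable using (Dec; yes; no; _⊎-dec_; ¬?; decidable-stable)
open import Relation.Nullary.Negation using (¬_; contradiction)
open import Relation.Unary using (Pred; _⊆_; _≐_)
import Relation.Unary as U

-- Counting in finite sets and relations of a partition.

module _ (Ω : FiniteSet) where
  open FiniteSet Ω

  count-positive : {P : Pred Carrier 0ℓ} (P? : U.Decidable P) →
                   (∀ {x y} → x ≈ y → P x → P y) → ∀ x → P x → 0 < count P?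
  count-positive P? P-resp x Px = filter-some P? (Any.map (λ x≈y → P-resp x≈y Px) (complete x))

  abstract
    count-witness : {P : Pred Carrier 0ℓ} (P? : U.Decidable P) → 0 < count P? → ∃[ x ] P x
    count-witness {P} P? = go elements
      where
      go : ∀ xs → 0 < length (filter P? xs) → ∃[ x ] P x
      go (x ∷ xs) lt with P? x
      ... | yes Px = x , Px
      ... | no  _  = go xs lt

module _ {Ω : FiniteSet} (P : Partition Ω) where
  open FiniteSet Ω using (refl; sym)
  open Partition P

  isRelation-resp : ∀ {R p q} → IsRelation R → p ≋ q → R q → R p
  isRelation-resp (I , s , to , from) p≋q Rq with i , q≋s ← to Rq = from (i , ≋-trans p≋q q≋s)

  saturated⇒isRelation : ∀ {R} → (∀ {p q} → p ≋ q → R q → R p) → IsRelation R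
  saturated⇒isRelation {R} R-resp =
    (Σ[ p ∈ Pair ] R p) , proj₁ , (λ {p} Rp → (p , Rp) , ≋-refl) , (λ { ((_ , Rp) , q≋p) → R-resp q≋p Rp })

  intersectionNumber-positive : ∀ {r s α β} γ → (α , γ) ≋ r → (γ , β) ≋ s →
                                0 < intersectionNumber r s (α , β)
  intersectionNumber-positive γ p q = count-positive Ω _
    (λ { x≈y (p , q) → ≋-trans (≈⇒≋ (refl , sym x≈y)) p , ≋-trans (≈⇒≋ (sym x≈y , refl)) q }) γ (p , q)

  intersectionNumber-witness : ∀ {r s α β} → 0 < intersectionNumber r s (α , β) →
                               ∃[ γ ] (α , γ) ≋ r × (γ , β) ≋ s
  intersectionNumber-witness = count-witness Ω _

-- A class of `P` is a relation of `P`, hence of `Q`, and so a union of classes of `Q`.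
≼⇒≋ : ∀ {Ω} (P Q : Partition Ω) → P ≼ Q → ∀ {p q} → Partition._≋_ Q p q → Partition._≋_ P p q
≼⇒≋ P Q P≼Q {q = q} p≋q =
  isRelation-resp Q (P≼Q (P.basis q) (saturated⇒isRelation P P.≋-trans)) p≋q P.≋-refl
  where module P = Partition P

≋⇒≼ : ∀ {Ω} (P Q : Partition Ω) → (∀ {p q} → Partition._≋_ Q p q → Partition._≋_ P p q) → P ≼ Q
≋⇒≼ P Q Q⊆P R R-rel = saturated⇒isRelation Q λ p≋q → isRelation-resp P R-rel (Q⊆P p≋q)

-- Paths and fibers in a coherent configuration.

module _ {Ω : FiniteSet} (X : CoherentConfiguration Ω) where
  open FiniteSet Ω using (Carrier; _≈_; refl; sym)
  open CoherentConfiguration X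

  -- The point `γ` makes an intersection number positive at `(α , β)`; by coherence it is positive
  -- at `(α′ , β′)` too.
  path : ∀ {α β α′ β′} → (α , β) ≋ (α′ , β′) → ∀ γ → ∃[ γ′ ] (α′ , γ′) ≋ (α , γ) × (γ′ , β′) ≋ (γ , β)
  path p γ = intersectionNumber-witness partition
    (≡.subst (0 <_) (coherent _ _ p) (intersectionNumber-positive partition γ ≋-refl ≋-refl))

  diagonal-≈ : ∀ {α α′ β} → (α , α′) ≋ (β , β) → α ≈ α′
  diagonal-≈ p = proj₂ (isRelation-resp partition diagonal p (_ , refl))

  -- On the path through `β` itself the last step is in the class of the loop at `β`, hence is a
  -- loop, necessarily at `β′`.
  ≋-target : ∀ {α β α′ β′} → (α , β) ≋ (α′ , β′) → (β , β) ≋ (β′ , β′)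
  ≋-target {β = β} p with γ , q , r ← path p β =
    ≋-trans (≋-sym r) (≈⇒≋ (diagonal-≈ r , refl))

  ≋-source : ∀ {α β α′ β′} → (α , β) ≋ (α′ , β′) → (α , α) ≋ (α′ , α′)
  ≋-source {α = α} p with γ , q , r ← path p α =
    ≋-trans (≋-sym q) (≈⇒≋ (refl , sym (diagonal-≈ q)))

  unionOfFibers-saturated : ∀ {Δ} → IsUnionOfFibers Δ →
                            ∀ {α β γ} → (α , β) ≋ (γ , γ) → Δ γ → 𝟙 Ω Δ (α , β)
  unionOfFibers-saturated (_ , _ , fiber , Δ⇒Γ , Γ⇒Δ) p γ∈Δ
    with i , γ∈Γ ← Δ⇒Γ γ∈Δ
    with s , Γ⇒s , s⇒Γ ← fiber i
    with α∈Γ , α≈β ← s⇒Γ (≋-trans p (Γ⇒s (γ∈Γ , refl)))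
    = Γ⇒Δ (i , α∈Γ) , α≈β

  -- Stated for loops only: the class of a pair determines the fibers of both ends, so this already
  -- yields completeness.
  IsDiscrete : Set
  IsDiscrete = ∀ {α β} → (α , α) ≋ (β , β) → α ≈ β

  discrete⇒≈ : IsDiscrete → ∀ {α β α′ β′} → (α , β) ≋ (α′ , β′) → α ≈ α′ × β ≈ β′
  discrete⇒≈ discrete p = discrete (≋-source p) , discrete (≋-target p)

  discrete⇒complete : IsDiscrete → IsComplete
  discrete⇒complete discrete s = s , discrete⇒≈ discrete , ≈⇒≋

  complete⇒≈ : IsComplete → ∀ {α β α′ β′} → (α , β) ≋ (α′ , β′) → α ≈ α′ × β ≈ β′
  complete⇒≈ complete {α′ = α′} {β′} p with _ , to , _ ← complete (α′ , β′)
    with a , b ← to p | a′ , b′ ← to {α′ , β′} ≋-refl =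
    Ω.trans a (sym a′) , Ω.trans b (sym b′)
    where module Ω = FiniteSet Ω

  -- E stands for the fiber partition of some refinement of X in which α and β are fixed: two points of
  -- one class have the same type over α, over β, and over every point known to be alone in its class.
  Separates : Carrier → Carrier → Set₁
  Separates α β = (E : Rel Carrier 0ℓ) →
    (∀ {γ δ} → E γ δ → (α , γ) ≋ (α , δ)) →
    (∀ {γ δ} → E γ δ → (β , γ) ≋ (β , δ)) →
    (∀ {ε} → (∀ {ε′} → E ε ε′ → ε ≈ ε′) → ∀ {γ δ} → E γ δ → (ε , γ) ≋ (ε , δ)) →
    ∀ {γ δ} → E γ δ → γ ≈ δ

-- Discrete configurations and bases.

trivialGroup : FiniteGroup
trivialGroup = record
  { group       = Terminal.group {0ℓ} {0ℓ}
  ; _≟_         = λ _ _ → yes _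
  ; elements    = _ ∷ []
  ; enumeration = λ _ → here _
  }

module _ (Ω : FiniteSet) where
  open FiniteSet Ω

  trivialAction : RightAction trivialGroup Ω
  trivialAction = record
    { _·_        = λ α _ → α
    ; ·-cong     = λ α≈β _ → α≈β
    ; ·-identity = λ _ → refl
    ; ·-assoc    = λ _ _ _ → refl
    }

  -- Built from orbits of the trivial group so that `Inv.scheme` supplies coherence.
  discreteConfiguration : CoherentConfiguration Ω
  discreteConfiguration = Inv.scheme trivialAction

module _ {Ω : FiniteSet} (X : CoherentConfiguration Ω) where
  open FiniteSet Ω using (Carrier; _≈_; refl; sym; trans)
  private
    module X = CoherentConfiguration X
    𝒟 = discreteConfiguration Ω
    module 𝒟 = CoherentConfiguration 𝒟

  ≼discrete : X.partition ≼ 𝒟.partition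
  ≼discrete = ≋⇒≼ X.partition 𝒟.partition λ { (_ , p , q) → X.≈⇒≋ (p , q) }

  fixed⇒singleton : (Y : CoherentConfiguration Ω) → ∀ {α} →
    CoherentConfiguration.IsRelation Y (singleton Ω (α , α)) →
    ∀ {ε} → CoherentConfiguration._≋_ Y (α , α) (ε , ε) → α ≈ ε
  fixed⇒singleton Y fixed p = sym (proj₁ (isRelation-resp Y.partition fixed (Y.≋-sym p) (refl , refl)))
    where module Y = CoherentConfiguration Y

  -- Any `Y` that refines `X` and fixes both points is discrete, by separation applied to its
  -- fibers; so the point extension is the discrete configuration.
  separates⇒isBase : ∀ α β → Separates X α β → IsBase X (α ∷ β ∷ [])
  separates⇒isBase α β separates =
    𝒟 , ((≼discrete , fixed ∷ fixed ∷ []) ,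
         λ { Y (X≼Y , α-fixed ∷ β-fixed ∷ []) → ≋⇒≼ 𝒟.partition (CoherentConfiguration.partition Y)
               λ p → _ , discrete⇒≈ Y (rigid Y X≼Y α-fixed β-fixed) p })
      , discrete⇒complete 𝒟 λ { (_ , p , _) → p }
    where
    fixed : ∀ {γ} → 𝒟.IsRelation (singleton Ω (γ , γ))
    fixed = saturated⇒isRelation 𝒟.partition λ { (_ , p , q) (p′ , q′) → trans p p′ , trans q q′ }

    rigid : ∀ Y → X.partition ≼ CoherentConfiguration.partition Y →
            CoherentConfiguration.IsRelation Y (singleton Ω (α , α)) →
            CoherentConfiguration.IsRelation Y (singleton Ω (β , β)) → IsDiscrete Y
    rigid Y X≼Y α-fixed β-fixed =
      separates (λ γ δ → (γ , γ) Y.≋ (δ , δ))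
        (transfer (fixed⇒singleton Y α-fixed)) (transfer (fixed⇒singleton Y β-fixed)) transfer
      where
      module Y = CoherentConfiguration Y
      transfer : ∀ {ε} → (∀ {ε′} → (ε , ε) Y.≋ (ε′ , ε′) → ε ≈ ε′) →
                 ∀ {γ δ} → (γ , γ) Y.≋ (δ , δ) → (ε , γ) X.≋ (ε , δ)
      -- The path from `δ` to `δ` through `ω` copies the one from `γ` to `γ` through `ε`. Since `ω`
      -- lies in the fiber of `ε`, it is `ε`.
      transfer {ε} ε-alone p with ω , _ , q ← path Y p ε =
        ≼⇒≋ X.partition Y.partition X≼Y
          (Y.≋-trans (Y.≋-sym q) (Y.≈⇒≋ (sym (ε-alone (≋-source Y (Y.≋-sym q))) , refl)))

-- Paths across an algebraic isomorphism.

module _ {Ω Ω′ : FiniteSet} {X : CoherentConfiguration Ω} {X′ : CoherentConfiguration Ω′}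
         (φ : AlgebraicIsomorphism X X′) where
  private
    module X  = CoherentConfiguration X
    module X′ = CoherentConfiguration X′
    module Ω′ = FiniteSet Ω′
  open AlgebraicIsomorphism φ
  open Bijection bijection using (injective; surjective; cong)

  to-surjective : ∀ p′ → ∃[ p ] to p X′.≋ p′
  to-surjective p′ with p , f ← surjective p′ = p , f X.≋-refl

  path-to : ∀ {α β α′ β′} → (α′ , β′) X′.≋ to (α , β) → ∀ γ →
            ∃[ γ′ ] (α′ , γ′) X′.≋ to (α , γ) × (γ′ , β′) X′.≋ to (γ , β)
  path-to p γ = intersectionNumber-witness X′.partition
    (≡.subst (0 <_) (≡.trans (preserves _ _ _) (X′.coherent _ _ (X′.≋-sym p)))
      (intersectionNumber-positive X.partition γ X.≋-refl X.≋-refl))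

  path-from : ∀ {α β α′ β′} → (α′ , β′) X′.≋ to (α , β) → ∀ γ′ →
              ∃[ γ ] (α′ , γ′) X′.≋ to (α , γ) × (γ′ , β′) X′.≋ to (γ , β)
  path-from {α} {β} {α′} {β′} p γ′
    with r , r≋ ← to-surjective (α′ , γ′) | s , s≋ ← to-surjective (γ′ , β′)
    with γ , p₁ , p₂ ← intersectionNumber-witness X.partition {r} {s} {α} {β}
           (≡.subst (0 <_) (≡.trans (X′.coherent _ _ p) (≡.sym (preserves r s (α , β))))
             (intersectionNumber-positive X′.partition γ′ (X′.≋-sym r≋) (X′.≋-sym s≋)))
    = γ , X′.≋-trans (X′.≋-sym r≋) (cong (X.≋-sym p₁)) , X′.≋-trans (X′.≋-sym s≋) (cong (X.≋-sym p₂))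

  -- Intersection numbers force loops to go to loops. The loop at `α′` corresponds to some pair
  -- starting at `α`; inserting `α` gives a point whose step to `α′` has the class of that loop. So
  -- the point is `α′`, and the step to it from `α′` is a loop in the class `to (α , α)`.
  to-source : ∀ {α β α′ β′} → (α′ , β′) X′.≋ to (α , β) → (α′ , α′) X′.≋ to (α , α)
  to-source {α} {α′ = α′} p
    with _ , q , _ ← path-from p α′
    with _ , r , s ← path-to q α =
    X′.≋-trans (X′.≈⇒≋ (Ω′.refl , Ω′.sym (diagonal-≈ X′ (X′.≋-trans s (X′.≋-sym q))))) r

  to-target : ∀ {α β α′ β′} → (α′ , β′) X′.≋ to (α , β) → (β′ , β′) X′.≋ to (β , β)
  to-target {β = β} {β′ = β′} p
    with _ , _ , q ← path-from p β′
    with _ , r , s ← path-to q β =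
    X′.≋-trans (X′.≈⇒≋ (diagonal-≈ X′ (X′.≋-trans r (X′.≋-sym q)) , Ω′.refl)) s

-- 2-extensions and 2-separability.

module _ {Ω : FiniteSet} (X : CoherentConfiguration Ω) where
  open FiniteSet Ω using (Carrier; _≈_; refl; sym)
  private module X = CoherentConfiguration X

  twice : Carrier → Vec Carrier 2
  twice = replicate 2

  module ExtensionProperties (Y : CoherentConfiguration (Ω ^ˢ 2))
    (X²≼Y : power X.partition 2 ≼ CoherentConfiguration.partition Y)
    (diag : CoherentConfiguration.IsUnionOfFibers Y (Diag Ω 2)) where
    private module Y = CoherentConfiguration Y

    ≋⇒coordinates : ∀ {γ₁ γ₂ δ₁ δ₂ γ₁′ γ₂′ δ₁′ δ₂′} →
      (γ₁ ∷ γ₂ ∷ [] , δ₁ ∷ δ₂ ∷ []) Y.≋ (γ₁′ ∷ γ₂′ ∷ [] , δ₁′ ∷ δ₂′ ∷ []) →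
      (γ₁ , δ₁) X.≋ (γ₁′ , δ₁′) × (γ₂ , δ₂) X.≋ (γ₂′ , δ₂′)
    ≋⇒coordinates p = let q = ≼⇒≋ (power X.partition 2) Y.partition X²≼Y p in q 0F , q 1F

    diag-saturated : ∀ {u v w} → (u , v) Y.≋ (w , w) → Diag Ω 2 w → 𝟙 (Ω ^ˢ 2) (Diag Ω 2) (u , v)
    diag-saturated = unionOfFibers-saturated Y diag

    module _ {α β : Carrier} (separates : Separates X α β) where
      base : Vec Carrier 2
      base = α ∷ β ∷ []

      base-separates : ∀ {γ δ} → (base , twice γ) Y.≋ (base , twice δ) → γ ≈ δ
      base-separates = separates (λ γ δ → (base , twice γ) Y.≋ (base , twice δ))
        (λ p → proj₁ (≋⇒coordinates p)) (λ p → proj₂ (≋⇒coordinates p)) transfer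
        where
        transfer : ∀ {ε} → (∀ {ε′} → (base , twice ε) Y.≋ (base , twice ε′) → ε ≈ ε′) →
                   ∀ {γ δ} → (base , twice γ) Y.≋ (base , twice δ) → (ε , γ) X.≋ (ε , δ)
        -- The path through `twice ε` yields `ω` in the fiber of `twice ε`. The diagonal is a union
        -- of fibers, so `ω` is diagonal, and `ε-alone` identifies it with `twice ε`.
        transfer {ε} ε-alone {γ} {δ} p
          with ω , q , r ← path Y p (twice ε)
          with (ε′ , ω≈ε′) , _ ← diag-saturated (≋-target Y q) (ε , FiniteSet.refl (Ω ^ˢ 2) {twice ε})
          = X.≋-trans (X.≋-sym (proj₁ (≋⇒coordinates r′))) (X.≈⇒≋ (sym ε≈ε′ , refl))
          where
          r′ : (twice ε′ , twice δ) Y.≋ (twice ε , twice γ)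
          r′ = Y.≋-trans (Y.≈⇒≋ (FiniteSet.sym (Ω ^ˢ 2) ω≈ε′ , FiniteSet.refl (Ω ^ˢ 2))) r
          ε≈ε′ : ε ≈ ε′
          ε≈ε′ = ε-alone (Y.≋-trans (Y.≋-sym q) (Y.≈⇒≋ (FiniteSet.refl (Ω ^ˢ 2) , ω≈ε′)))

module _ {Ω : FiniteSet} (X : CoherentConfiguration Ω) where
  open FiniteSet Ω using (Carrier; _≈_; refl; sym)
  private module X = CoherentConfiguration X

  separates⇒2-separable : ∀ α β → Separates X α β → IsSeparable 2 X
  separates⇒2-separable α β separates {Ω′} X′ φ
    (Y , Y′ , ((X²≼Y , diag) , _) , _ , ψ , ψ-diag , ψ-product) = f-bijection , f-induces
    where
    module Ω′  = FiniteSet Ω′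
    module Ω²  = FiniteSet (Ω ^ˢ 2)
    module Ω′² = FiniteSet (Ω′ ^ˢ 2)
    module X′  = CoherentConfiguration X′
    module Y  = CoherentConfiguration Y
    module Y′ = CoherentConfiguration Y′
    module φ  = AlgebraicIsomorphism φ
    module ψ  = AlgebraicIsomorphism ψ
    module φ′ = Bijection φ.bijection
    module ψ′ = Bijection ψ.bijection
    module E  = ExtensionProperties X Y X²≼Y diag

    p : Vec Carrier 2
    p = E.base separates

    diag-to : ∀ {γ v} → (v , v) Y′.≋ ψ.to (twice X γ , twice X γ) → ∃[ γ′ ] v Ω′².≈ twice X′ γ′
    diag-to {γ} v≋ = proj₁ (proj₁ ψ-diag
      (((twice X γ , twice X γ) , λ q → E.diag-saturated q (γ , Ω².refl {twice X γ})) , v≋))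

    diag-from : ∀ {γ′ v} → (twice X′ γ′ , twice X′ γ′) Y′.≋ ψ.to (v , v) → ∃[ γ ] v Ω².≈ twice X γ
    diag-from {γ′} q with (s , s⊆) , r ← proj₂ ψ-diag ((γ′ , Ω′².refl {twice X′ γ′}) , Ω′².refl {twice X′ γ′}) =
      proj₁ (s⊆ (ψ′.injective (Y′.≋-trans (Y′.≋-sym q) r)))

    abstract
      p′-exists : ∃[ p′ ] (p′ , p′) Y′.≋ ψ.to (p , p)
      -- The components of `ψ.to (p , p)` are not known to be equal; `to-source` puts the loop at
      -- the first one into the same class.
      p′-exists = proj₁ (ψ.to (p , p)) , to-source ψ {β = p} {β′ = proj₂ (ψ.to (p , p))} Y′.≋-refl

    p′ : Vec Ω′.Carrier 2
    p′ = proj₁ p′-exists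

    -- The graph of the bijection to be built. It is kept as a relation because it is shown to be
    -- single-valued last: separation is given in `X`, not in `X′`.
    _↝_ : Carrier → Ω′.Carrier → Set
    γ ↝ γ′ = (p′ , twice X′ γ′) Y′.≋ ψ.to (p , twice X γ)

    twice-cong : ∀ {γ δ} → γ ≈ δ → twice X γ Ω².≈ twice X δ
    twice-cong γ≈δ = γ≈δ ∷ γ≈δ ∷ []

    ↝-total : ∀ γ → ∃[ γ′ ] γ ↝ γ′
    ↝-total γ =
      let v  , q , _ = path-to ψ (proj₂ p′-exists) (twice X γ)
          γ′ , v≈    = diag-to (to-target ψ q)
      in γ′ , Y′.≋-trans (Y′.≈⇒≋ (Ω′².refl , Ω′².sym v≈)) q

    ↝-surjective : ∀ γ′ → ∃[ γ ] γ ↝ γ′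
    ↝-surjective γ′ =
      let v , q , _ = path-from ψ (proj₂ p′-exists) (twice X′ γ′)
          γ , v≈    = diag-from (to-target ψ q)
      in γ , Y′.≋-trans q (ψ′.cong (Y.≈⇒≋ (Ω².refl , v≈)))

    ↝-injective : ∀ {γ δ γ′} → γ ↝ γ′ → δ ↝ γ′ → γ ≈ δ
    ↝-injective q r = E.base-separates separates (ψ′.injective (Y′.≋-trans (Y′.≋-sym q) r))

    -- The triangle `p′`, `twice X′ γ′`, `twice X′ δ′` is pulled back to one on `p` and `twice X δ`.
    -- Its third vertex is a diagonal vector whose point is related to `γ′` by `↝`, so by
    -- injectivity it is `twice X γ`.
    ↝-arrow : ∀ {γ δ γ′ δ′} → γ ↝ γ′ → δ ↝ δ′ →
              (twice X′ γ′ , twice X′ δ′) Y′.≋ ψ.to (twice X γ , twice X δ)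
    ↝-arrow {γ′ = γ′} q r =
      let _ , s , t = path-from ψ r (twice X′ γ′)
          _ , w≈    = diag-from (to-target ψ s)
          γ₀≈γ      = ↝-injective (Y′.≋-trans s (ψ′.cong (Y.≈⇒≋ (Ω².refl , w≈)))) q
      in Y′.≋-trans t (ψ′.cong (Y.≈⇒≋ (Ω².trans w≈ (twice-cong γ₀≈γ) , Ω².refl)))

    -- The arrows from `γ′` to `δ′` and from `γ′` to `γ′` lie in the same class, so the former is a
    -- loop as well.
    ↝-functional : ∀ {γ δ γ′ δ′} → γ ≈ δ → γ ↝ γ′ → δ ↝ δ′ → γ′ Ω′.≈ δ′
    ↝-functional γ≈δ q r = Pointwise.head (diagonal-≈ Y′ (Y′.≋-trans (↝-arrow q r)
      (Y′.≋-trans (ψ′.cong (Y.≈⇒≋ (Ω².refl , twice-cong (sym γ≈δ)))) (Y′.≋-sym (↝-arrow q q)))))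

    ↝-types : ∀ {γ δ γ′ δ′} s → γ ↝ γ′ → δ ↝ δ′ → (γ , δ) X.≋ s → (γ′ , δ′) X′.≋ φ.to s
    ↝-types {γ} {δ} s q r γδ≋s = proj₁ (ψ-product (s ∷ s ∷ []))
      ((_ , types) , ↝-arrow q r) 0F
      where
      types : Y.basis (twice X γ , twice X δ) ⊆ product X.partition (s ∷ s ∷ [])
      types {_ ∷ _ ∷ [] , _ ∷ _ ∷ []} t 0F = X.≋-trans (proj₁ (E.≋⇒coordinates t)) γδ≋s
      types {_ ∷ _ ∷ [] , _ ∷ _ ∷ []} t 1F = X.≋-trans (proj₂ (E.≋⇒coordinates t)) γδ≋s

    f : Carrier → Ω′.Carrier
    f γ = proj₁ (↝-total γ)

    γ↝fγ : ∀ γ → γ ↝ f γ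
    γ↝fγ γ = proj₂ (↝-total γ)

    f-bijection : Bijection (FiniteSet.setoid Ω) Ω′.setoid
    f-bijection = record
      { to        = f
      ; cong      = λ γ≈δ → ↝-functional γ≈δ (γ↝fγ _) (γ↝fγ _)
      ; bijective = (λ {γ} {δ} fγ≈fδ → ↝-injective
                        (Y′.≋-trans (Y′.≈⇒≋ (Ω′².refl , Ω′.sym fγ≈fδ ∷ Ω′.sym fγ≈fδ ∷ [])) (γ↝fγ γ)) (γ↝fγ δ))
                  , (λ γ′ → let γ , q = ↝-surjective γ′ in
                            γ , λ z≈γ → ↝-functional z≈γ (γ↝fγ _) q)
      }

    f-induces : ∀ s → image {Ω} {Ω′} f-bijection (X.basis s) ≐ X′.basis (φ.to s)
    f-induces s =
        (λ { (γ , δ , γδ≋s , γ′≈ , δ′≈) →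
             X′.≋-trans (X′.≈⇒≋ (γ′≈ , δ′≈)) (↝-types s (γ↝fγ γ) (γ↝fγ δ) γδ≋s) })
      , (λ { {γ′ , δ′} q →
             let γ , γ↝ = ↝-surjective γ′
                 δ , δ↝ = ↝-surjective δ′
             in γ , δ
              , φ′.injective (X′.≋-trans (X′.≋-sym (↝-types (γ , δ) γ↝ δ↝ X.≋-refl)) q)
              , ↝-functional refl γ↝ (γ↝fγ γ) , ↝-functional refl δ↝ (γ↝fγ δ) })

-- Point stabilizers and bases.

module _ {G : FiniteGroup} {Ω : FiniteSet} (act : RightAction G Ω) where
  private
    module G = FiniteGroup G
    module Ω = FiniteSet Ω
    module I = Inv act
  open RightAction act

  module _ (α : Ω.Carrier) where
    Stabilizer : Set
    Stabilizer = ∃[ g ] α · g Ω.≈ α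

    restrict : List G.Carrier → List Stabilizer
    restrict []       = []
    restrict (g ∷ gs) with (α · g) Ω.≟ α
    ... | yes p = (g , p) ∷ restrict gs
    ... | no  _ = restrict gs

    restrict-complete : ∀ {g} gs → α · g Ω.≈ α → Any (g G.≈_) gs → Any (λ h → g G.≈ proj₁ h) (restrict gs)
    restrict-complete (h ∷ gs) p g∈ with (α · h) Ω.≟ α | g∈
    ... | yes _ | here  g≈h  = here g≈h
    ... | yes _ | there g∈gs = there (restrict-complete gs p g∈gs)
    ... | no ¬q | here  g≈h  = contradiction (Ω.trans (·-cong Ω.refl (G.sym g≈h)) p) ¬q
    ... | no _  | there g∈gs = restrict-complete gs p g∈gs

    stabilizer : FiniteGroup
    stabilizer = record
      { group = record
        { Carrier = Stabilizer
        ; _≈_     = λ g h → proj₁ g G.≈ proj₁ h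
        ; _∙_     = λ (g , p) (h , q) → g G.∙ h , I.compose g h p q
        ; ε       = G.ε , ·-identity α
        ; _⁻¹     = λ (g , p) → g G.⁻¹ , I.undo g p
        ; isGroup = record
          { isMonoid = record
            { isSemigroup = record
              { isMagma = record
                { isEquivalence = record { refl = G.refl ; sym = G.sym ; trans = G.trans }
                ; ∙-cong        = G.∙-cong
                }
              ; assoc = λ g h k → G.assoc (proj₁ g) (proj₁ h) (proj₁ k)
              }
            ; identity = (λ g → G.identityˡ (proj₁ g)) , λ g → G.identityʳ (proj₁ g)
            }
          ; inverse = (λ g → G.inverseˡ (proj₁ g)) , λ g → G.inverseʳ (proj₁ g)
          ; ⁻¹-cong = G.⁻¹-cong
          }
        }
      ; _≟_         = λ g h → proj₁ g G.≟ proj₁ h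
      ; elements    = restrict G.elements
      ; enumeration = λ (g , p) → restrict-complete G.elements p (G.enumeration g)
      }

    stabilizerAction : RightAction stabilizer Ω
    stabilizerAction = record
      { _·_        = λ β g → β · proj₁ g
      ; ·-cong     = ·-cong
      ; ·-identity = ·-identity
      ; ·-assoc    = λ β g h → ·-assoc β (proj₁ g) (proj₁ h)
      }

    -- The orbits of the stabilizer of `α` refine the scheme and fix `α`, so they refine the point
    -- extension, yet `γ` and `γ · g` stay in one fiber. The condition on `Δ` covers the empty list
    -- and one-point lists together.
    stabilizer-moves⇒¬isBase : ∀ {Δ} → All (α Ω.≈_) Δ → ∀ g → α · g Ω.≈ α → ∀ γ → ¬ (γ · g Ω.≈ γ) →
                               ¬ IsBase I.scheme Δ
    stabilizer-moves⇒¬isBase Δ≈α g p γ γg≉γ (Y , (_ , smallest) , complete) =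
      γg≉γ (proj₁ (complete⇒≈ Y complete (≼⇒≋ Y.partition Z.partition Y≼Z moved)))
      where
      module Y = CoherentConfiguration Y
      module Z = CoherentConfiguration (Inv.scheme stabilizerAction)

      moved : (γ · g , γ · g) Z.≋ (γ , γ)
      moved = Z.≋-sym {γ , γ} {γ · g , γ · g} ((g , p) , Ω.refl , Ω.refl)

      fixed : ∀ {β} → α Ω.≈ β → Z.IsRelation (singleton Ω (β , β))
      fixed {β} α≈β = saturated⇒isRelation Z.partition λ
        { ((h , αh≈α) , p , q) (p′ , q′) → back h αh≈α p p′ , back h αh≈α q q′ }
        where
        back : ∀ h → α · h Ω.≈ α → ∀ {x y} → x · h Ω.≈ y → y Ω.≈ β → x Ω.≈ β
        back h αh≈α {x} xh≈y y≈β = Ω.trans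
          (Ω.trans (Ω.sym (I.undo h (Ω.trans xh≈y (Ω.trans y≈β (Ω.sym α≈β))))) (I.undo h αh≈α))
          α≈β

      Y≼Z : Y.partition ≼ Z.partition
      Y≼Z = smallest (Inv.scheme stabilizerAction)
        ( ≋⇒≼ I.orbits Z.partition (λ { ((g , _) , p , q) → g , p , q })
        , All.map fixed Δ≈α)

-- Group identities for cosets.

module _ (G : Group 0ℓ 0ℓ) where
  open Group G renaming (_∙_ to infixl 7 _·_)
  open GroupProperties G using (⁻¹-anti-homo-∙; //-rightDividesˡ; //-rightDividesʳ; \\-leftDividesˡ)
  open SetoidReasoning setoid

  //-telescope : ∀ x y z → (x // y) · (y // z) ≈ x // z
  //-telescope x y z = begin
    (x // y) · (y // z)  ≈⟨ assoc (x // y) y (z ⁻¹) ⟨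
    ((x // y) · y) // z  ≈⟨ ∙-congʳ (//-rightDividesˡ y x) ⟩
    x // z               ∎

  -- If `g` fixes the right coset of `y` and takes that of `x` to that of `z`, then `(y · g) // y`
  -- and `(x · g) // z` lie in the subgroup, so `x // y` and `z // y` share a double coset.
  //-intertwine : ∀ x y z g → (x // y) · ((y · g) // y) ≈ ((x · g) // z) · (z // y)
  //-intertwine x y z g = begin
    (x // y) · ((y · g) // y)        ≈⟨ ∙-congˡ (assoc y g (y ⁻¹)) ⟩
    (x // y) · (y · (g // y))        ≈⟨ assoc (x // y) y (g // y) ⟨
    ((x // y) · y) · (g // y)        ≈⟨ ∙-congʳ (//-rightDividesˡ y x) ⟩
    x · (g // y)                     ≈⟨ assoc x g (y ⁻¹) ⟨
    (x · g) // y                     ≈⟨ //-telescope (x · g) z y ⟨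
    ((x · g) // z) · (z // y)        ∎

  x//tx≈t⁻¹ : ∀ t x → x // (t · x) ≈ t ⁻¹
  x//tx≈t⁻¹ t x = begin
    x // (t · x)         ≈⟨ ∙-congˡ (⁻¹-anti-homo-∙ t x) ⟩
    x · (x ⁻¹ · t ⁻¹)    ≈⟨ \\-leftDividesˡ x (t ⁻¹) ⟩
    t ⁻¹                 ∎

  [y//tx]t≈y//x : ∀ t x y → (y // (t · x)) · t ≈ y // x
  [y//tx]t≈y//x t x y = begin
    (y // (t · x)) · t         ≈⟨ ∙-congʳ (∙-congˡ (⁻¹-anti-homo-∙ t x)) ⟩
    (y · (x ⁻¹ · t ⁻¹)) · t    ≈⟨ ∙-congʳ (assoc y (x ⁻¹) (t ⁻¹)) ⟨
    ((y // x) // t) · t        ≈⟨ //-rightDividesˡ t (y // x) ⟩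
    y // x                     ∎

  conjugate : ∀ x g → (x · (x ⁻¹ · (g · x))) // x ≈ g
  conjugate x g = trans (∙-congʳ (\\-leftDividesˡ x (g · x))) (//-rightDividesʳ x g)

  conjugate-shifted : ∀ u x g → (((u · x) · (x ⁻¹ · (g · x))) // (u · x)) · u ≈ u · g
  conjugate-shifted u x g = begin
    (((u · x) · (x ⁻¹ · (g · x))) // (u · x)) · u  ≈⟨ [y//tx]t≈y//x u x _ ⟩
    ((u · x) · (x ⁻¹ · (g · x))) // x              ≈⟨ ∙-congʳ (assoc u x _) ⟩
    (u · (x · (x ⁻¹ · (g · x)))) // x              ≈⟨ assoc u _ (x ⁻¹) ⟩
    u · ((x · (x ⁻¹ · (g · x))) // x)              ≈⟨ ∙-congˡ (conjugate x g) ⟩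
    u · g                                          ∎

-- Arithmetic in the field.

module _ {q : ℕ} (F : FieldOfOrder q) where
  open FieldOfOrder F
  open SetoidReasoning setoid

  *-cancelˡ-nonzero : ∀ {x y z} → ¬ x ≈ 0# → x * y ≈ x * z → y ≈ z
  *-cancelˡ-nonzero {x} {y} {z} x≉0 xy≈xz with x⁻¹ , xx⁻¹≈1 ← invertible x x≉0 = begin
    y              ≈⟨ cancel y ⟨
    x⁻¹ * (x * y)  ≈⟨ *-congˡ xy≈xz ⟩
    x⁻¹ * (x * z)  ≈⟨ cancel z ⟩
    z              ∎
    where
    cancel : ∀ w → x⁻¹ * (x * w) ≈ w
    cancel w = begin
      x⁻¹ * (x * w)  ≈⟨ *-assoc x⁻¹ x w ⟨
      x⁻¹ * x * w    ≈⟨ *-congʳ (trans (*-comm x⁻¹ x) xx⁻¹≈1) ⟩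
      1# * w         ≈⟨ *-identityˡ w ⟩
      w              ∎

  *-nonzero : ∀ {x y} → ¬ x ≈ 0# → ¬ y ≈ 0# → ¬ x * y ≈ 0#
  *-nonzero x≉0 y≉0 xy≈0 = y≉0 (*-cancelˡ-nonzero x≉0 (trans xy≈0 (sym (zeroʳ _))))

  -- Both `(u , v)` and `(u′ , v′)` are proportional to `(u * y , v * y)`; the factor `y′` is
  -- nonzero because `v * y` is.
  proportional : ∀ {u v y u′ v′ y′} → ¬ v ≈ 0# → ¬ y ≈ 0# →
                 u * y ≈ u′ * y′ → v * y ≈ v′ * y′ → u′ * v ≈ v′ * u
  proportional {u} {v} {y} {u′} {v′} {y′} v≉0 y≉0 uy≈ vy≈ = *-cancelˡ-nonzero (*-nonzero y≉0 y′≉0) (begin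
    y * y′ * (u′ * v)    ≈⟨ solve 4 (λ y y′ u′ v → y :* y′ :* (u′ :* v) := u′ :* y′ :* (v :* y)) refl y y′ u′ v ⟩
    u′ * y′ * (v * y)    ≈⟨ *-cong (sym uy≈) vy≈ ⟩
    u * y * (v′ * y′)    ≈⟨ solve 4 (λ u y v′ y′ → u :* y :* (v′ :* y′) := y :* y′ :* (v′ :* u)) refl u y v′ y′ ⟩
    y * y′ * (v′ * u)    ∎)
    where
    open Solver F using (solve; _:*_; _:=_)
    y′≉0 : ¬ y′ ≈ 0#
    y′≉0 y′≈0 = *-nonzero v≉0 y≉0 (trans vy≈ (trans (*-congˡ y′≈0) (zeroʳ v′)))

  scaled-product : ∀ {x y x′ y′ t t′ u u′} → t * t′ ≈ 1# → u * u′ ≈ 1# →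
                   x * t ≈ u * x′ → y * t′ ≈ u′ * y′ → x * y ≈ x′ * y′
  scaled-product {x} {y} {x′} {y′} {t} {t′} {u} {u′} tt′≈1 uu′≈1 p p′ = begin
    x * y                  ≈⟨ *-identityʳ (x * y) ⟨
    x * y * 1#             ≈⟨ *-congˡ tt′≈1 ⟨
    x * y * (t * t′)       ≈⟨ solve 4 (λ x y t t′ → x :* y :* (t :* t′) := x :* t :* (y :* t′)) refl x y t t′ ⟩
    x * t * (y * t′)       ≈⟨ *-cong p p′ ⟩
    u * x′ * (u′ * y′)     ≈⟨ solve 4 (λ u x′ u′ y′ → u :* x′ :* (u′ :* y′) := u :* u′ :* (x′ :* y′)) refl u x′ u′ y′ ⟩
    u * u′ * (x′ * y′)     ≈⟨ *-congʳ uu′≈1 ⟩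
    1# * (x′ * y′)         ≈⟨ *-identityˡ (x′ * y′) ⟩
    x′ * y′                ∎
    where open Solver F using (solve; _:*_; _:=_)

  scaled-zero : ∀ {x x′ t u u′} → u * u′ ≈ 1# → x * t ≈ u * x′ → x ≈ 0# → x′ ≈ 0#
  scaled-zero {x} {x′} {t} {u} {u′} uu′≈1 p x≈0 = *-cancelˡ-nonzero u≉0 (begin
    u * x′   ≈⟨ p ⟨
    x * t    ≈⟨ *-congʳ x≈0 ⟩
    0# * t   ≈⟨ zeroˡ t ⟩
    0#       ≈⟨ zeroʳ u ⟨
    u * 0#   ∎)
    where
    u≉0 : ¬ u ≈ 0#
    u≉0 u≈0 = 1≉0 (trans (sym uu′≈1) (trans (*-congʳ u≈0) (zeroˡ u′)))

  roots : Fin 3 → Carrier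
  roots 0F = 0#
  roots 1F = 1#
  roots 2F = - 1#

  -- The elements to avoid when building diag(x, 1/x) with distinct entries: 0 has no inverse, and
  -- the others are their own.
  IsRoot : Carrier → Set
  IsRoot x = x ≈ 0# ⊎ x * x ≈ 1#

  root? : ∀ x → Dec (IsRoot x)
  root? x = _≟ᶠ_ F x 0# ⊎-dec _≟ᶠ_ F (x * x) 1#

  root⇒roots : ∀ {x} → IsRoot x → ∃[ k ] x ≈ roots k
  root⇒roots (inj₁ x≈0) = 0F , x≈0
  root⇒roots {x} (inj₂ x²≈1) with _≟ᶠ_ F (x + 1#) 0#
  ... | yes x+1≈0 = 2F , inverseˡ-unique x 1# x+1≈0
    where open GroupProperties +-group using (inverseˡ-unique)
  ... | no  x+1≉0 = 1F , *-cancelˡ-nonzero x+1≉0 (begin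
    (x + 1#) * x    ≈⟨ distribʳ x x 1# ⟩
    x * x + 1# * x  ≈⟨ +-cong x²≈1 (*-identityˡ x) ⟩
    1# + x          ≈⟨ +-comm 1# x ⟩
    x + 1#          ≈⟨ *-identityʳ (x + 1#) ⟨
    (x + 1#) * 1#   ∎)

  -- x (x² - 1) has at most three roots.
  ∃-nonroot : q > 3 → ∃[ x ] ¬ IsRoot x
  ∃-nonroot q>3 with Fin.any? (λ i → ¬? (root? (Inverse.from finite i)))
  ... | yes (i , ¬root) = Inverse.from finite i , ¬root
  ... | no  all-roots   =
    let i , j , i<j , same = Fin.pigeonhole q>3 (proj₁ ∘ classify)
    in contradiction
         (≡.trans (≡.sym (strictlyInverseˡ i)) (≡.trans (to-cong (begin
           from i                       ≈⟨ proj₂ (classify i) ⟩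
           roots (proj₁ (classify i))   ≡⟨ ≡.cong roots same ⟩
           roots (proj₁ (classify j))   ≈⟨ proj₂ (classify j) ⟨
           from j                       ∎)) (strictlyInverseˡ j)))
         (Fin.<⇒≢ i<j)
    where
    open Inverse finite using (from; to-cong; strictlyInverseˡ)
    classify : ∀ i → ∃[ k ] from i ≈ roots k
    classify i = root⇒roots (decidable-stable (root? (from i)) λ ¬root → all-roots (i , ¬root))

-- Cosets and double cosets of the Cartan subgroup as matrices.

module _ {q : ℕ} (F : FieldOfOrder q) where
  open FieldOfOrder F
  open SL₂
  private
    module G = FiniteGroup (PSL₂ F)
    module Ω = FiniteSet (rightCosets (Cartan F))
    module X = CoherentConfiguration (cartanScheme F)

  infixl 7 _⊙_ _⊘_
  _⊙_ _⊘_ : SL₂ F → SL₂ F → SL₂ F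
  M ⊙ N = _∙_ F M N
  M ⊘ N = M ⊙ inv F N

  -- Equality is exact here, whereas `PSL₂` identifies matrices up to sign; group identities thus
  -- become equations between entries.
  SL₂-group : Group 0ℓ 0ℓ
  SL₂-group = record
    { Carrier = SL₂ F
    ; _≈_     = _≈ᴹ_ F
    ; _∙_     = _⊙_
    ; ε       = I F
    ; _⁻¹     = inv F
    ; isGroup = record
      { isMonoid = record
        { isSemigroup = record
          { isMagma = record
            { isEquivalence = record
              { refl  = λ {M} → ≈ᴹ-refl F {M}
              ; sym   = λ {M} {N} → ≈ᴹ-sym F {M} {N}
              ; trans = λ {M} {N} {K} → ≈ᴹ-trans F {M} {N} {K}
              }
            ; ∙-cong = λ {M} {M′} {N} {N′} → ∙-congᴹ F {M} {M′} {N} {N′}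
            }
          ; assoc = ∙-assoc F
          }
        ; identity = (λ M → 1x+0y F _ _ , 1x+0y F _ _ , 0x+1y F _ _ , 0x+1y F _ _)
                   , (λ M → x1+y0 F _ _ , x0+y1 F _ _ , x1+y0 F _ _ , x0+y1 F _ _)
        }
      ; inverse = invˡ F , invʳ F
      ; ⁻¹-cong = λ (p , q , r , s) → s , -‿cong q , -‿cong r , p
      }
    }

  private module SL = Group SL₂-group

  diagonal⇒≈ᴴ : ∀ M N → IsDiagonal F (M ⊘ N) → M Ω.≈ N
  diagonal⇒≈ᴴ M N p = M ⊘ N , p , G.refl {M ⊘ N}

  ≈ᴴ⇒diagonal : ∀ M N → M Ω.≈ N → IsDiagonal F (M ⊘ N)
  ≈ᴴ⇒diagonal M N = inCartan⇒diagonal F (M ⊘ N)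

  private
    x*y+z*0 : ∀ {x y z w} → w ≈ 0# → x * y + z * w ≈ x * y
    x*y+z*0 w≈0 = trans (+-congˡ (trans (*-congˡ w≈0) (zeroʳ _))) (+-identityʳ _)

    x*0+z*w : ∀ {x y z w} → y ≈ 0# → x * y + z * w ≈ z * w
    x*0+z*w y≈0 = trans (+-comm _ _) (x*y+z*0 y≈0)

    x*y+0*w : ∀ {x y z w} → z ≈ 0# → x * y + z * w ≈ x * y
    x*y+0*w z≈0 = trans (+-congˡ (trans (*-congʳ z≈0) (zeroˡ _))) (+-identityʳ _)

    0*y+z*w : ∀ {x y z w} → x ≈ 0# → x * y + z * w ≈ z * w
    0*y+z*w x≈0 = trans (+-comm _ _) (x*y+0*w x≈0)

  diagonal-det : ∀ D → IsDiagonal F D → a D * d D ≈ 1#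
  diagonal-det D (b≈0 , c≈0) =
    trans (det⁺ F (det D)) (trans (+-congˡ (trans (*-congʳ b≈0) (zeroˡ _))) (+-identityʳ 1#))

  -- The equation A D = E B with D = diag(t, t′) and E = diag(u, u′), entry by entry: `A` and `B`
  -- lie in one double coset of the diagonal subgroup.
  record Scaled (A B : SL₂ F) : Set where
    field
      t t′ u u′ : Carrier
      tt′≈1 : t * t′ ≈ 1#
      uu′≈1 : u * u′ ≈ 1#
      a-scaled : a A * t  ≈ u  * a B
      b-scaled : b A * t′ ≈ u  * b B
      c-scaled : c A * t  ≈ u′ * c B
      d-scaled : d A * t′ ≈ u′ * d B

    private u′u≈1 = trans (*-comm u′ u) uu′≈1

    ad-invariant : a A * d A ≈ a B * d B
    ad-invariant = scaled-product F tt′≈1 uu′≈1 a-scaled d-scaled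

    bc-invariant : b A * c A ≈ b B * c B
    bc-invariant = scaled-product F (trans (*-comm t′ t) tt′≈1) uu′≈1 b-scaled c-scaled

    b-zero : b A ≈ 0# → b B ≈ 0#
    b-zero = scaled-zero F uu′≈1 b-scaled

    c-zero : c A ≈ 0# → c B ≈ 0#
    c-zero = scaled-zero F u′u≈1 c-scaled

    d-zero : d A ≈ 0# → d B ≈ 0#
    d-zero = scaled-zero F u′u≈1 d-scaled

  scaled-resp : ∀ {A A′ B B′} → A SL.≈ A′ → B SL.≈ B′ → Scaled A B → Scaled A′ B′
  scaled-resp (p , q , r , s) (p′ , q′ , r′ , s′) S = record
    { tt′≈1 = tt′≈1
    ; uu′≈1 = uu′≈1
    ; a-scaled = trans (*-congʳ (sym p)) (trans a-scaled (*-congˡ p′))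
    ; b-scaled = trans (*-congʳ (sym q)) (trans b-scaled (*-congˡ q′))
    ; c-scaled = trans (*-congʳ (sym r)) (trans c-scaled (*-congˡ r′))
    ; d-scaled = trans (*-congʳ (sym s)) (trans d-scaled (*-congˡ s′))
    }
    where open Scaled S

  diagonals⇒scaled : ∀ A B D E → IsDiagonal F D → IsDiagonal F E → A ⊙ D SL.≈ E ⊙ B → Scaled A B
  diagonals⇒scaled A B D E D-diag@(bD , cD) E-diag@(bE , cE) (p , q , r , s) = record
    { tt′≈1 = diagonal-det D D-diag
    ; uu′≈1 = diagonal-det E E-diag
    ; a-scaled = trans (sym (x*y+z*0 cD)) (trans p (x*y+0*w bE))
    ; b-scaled = trans (sym (x*0+z*w bD)) (trans q (x*y+0*w bE))
    ; c-scaled = trans (sym (x*y+z*0 cD)) (trans r (0*y+z*w cE))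
    ; d-scaled = trans (sym (x*0+z*w bD)) (trans s (0*y+z*w cE))
    }

  ∼⇒scaled : ∀ ε γ δ → (ε , γ) X.≋ (ε , δ) → Scaled (γ ⊘ ε) (δ ⊘ ε)
  ∼⇒scaled ε γ δ (g , εg≈ε , γg≈δ) = diagonals⇒scaled (γ ⊘ ε) (δ ⊘ ε)
    ((ε ⊙ g) ⊘ ε) ((γ ⊙ g) ⊘ δ)
    (≈ᴴ⇒diagonal (ε ⊙ g) ε εg≈ε) (≈ᴴ⇒diagonal (γ ⊙ g) δ γg≈δ)
    (//-intertwine SL₂-group γ ε δ g)

  -- Separation of cosets by two origins.

  upper lower : SL₂ F
  upper = mat 1# 1# 0# 1# (det⁻ F (trans (*-identityʳ 1#) (sym (trans (+-congˡ (zeroʳ 1#)) (+-identityʳ 1#)))))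
  lower = mat 1# 0# 1# 1# (det⁻ F (trans (*-identityʳ 1#) (sym (trans (+-congˡ (zeroˡ 1#)) (+-identityʳ 1#)))))

  -- `origin′` is an inverse so that the invariants of (origin′ , γ) are those of γ ⊙ lower, free of signs.
  origin origin′ : SL₂ F
  origin  = I F
  origin′ = inv F lower

  origin-scaled : ∀ γ δ → (origin , γ) X.≋ (origin , δ) → Scaled γ δ
  origin-scaled γ δ p = scaled-resp {γ ⊘ origin} {γ} {δ ⊘ origin} {δ}
    (//origin γ) (//origin δ) (∼⇒scaled origin γ δ p)
    where
    //origin : ∀ M → M ⊘ origin SL.≈ M
    //origin M = SL.trans {M ⊘ origin} {M ⊙ origin} {M}
      (SL.∙-congˡ {M} {inv F origin} {origin} (GroupProperties.ε⁻¹≈ε SL₂-group)) (SL.identityʳ M)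

  origin′-scaled : ∀ γ δ → (origin′ , γ) X.≋ (origin′ , δ) → Scaled (γ ⊙ lower) (δ ⊙ lower)
  origin′-scaled γ δ p = scaled-resp {γ ⊘ origin′} {γ ⊙ lower} {δ ⊘ origin′} {δ ⊙ lower}
    (//origin′ γ) (//origin′ δ) (∼⇒scaled origin′ γ δ p)
    where
    //origin′ : ∀ M → M ⊘ origin′ SL.≈ M ⊙ lower
    //origin′ M = SL.∙-congˡ {M} {inv F origin′} {lower} (GroupProperties.⁻¹-involutive SL₂-group lower)

  bc-⊙-lower : ∀ M → b (M ⊙ lower) * c (M ⊙ lower) ≈ b M * c M + b M * d M
  bc-⊙-lower M = trans (*-cong (x0+y1 F (a M) (b M)) (+-cong (*-identityʳ (c M)) (*-identityʳ (d M))))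
                       (distribˡ (b M) (c M) (d M))

  -- Multiplying by `lower` on the right adds the second column to the first, so `origin′` sees bc +
  -- bd where `origin` sees bc.
  bd-invariant : ∀ {γ δ} → Scaled γ δ → Scaled (γ ⊙ lower) (δ ⊙ lower) → b γ * d γ ≈ b δ * d δ
  bd-invariant {γ} {δ} S S′ = ∙-cancelˡ (b γ * c γ) (b γ * d γ) (b δ * d δ) (begin
    b γ * c γ + b γ * d γ                  ≈⟨ bc-⊙-lower γ ⟨
    b (γ ⊙ lower) * c (γ ⊙ lower)          ≈⟨ Scaled.bc-invariant S′ ⟩
    b (δ ⊙ lower) * c (δ ⊙ lower)          ≈⟨ bc-⊙-lower δ ⟩
    b δ * c δ + b δ * d δ                  ≈⟨ +-congʳ (Scaled.bc-invariant S) ⟨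
    b γ * c γ + b δ * d δ                  ∎)
    where
    open GroupProperties +-group using (∙-cancelˡ)
    open SetoidReasoning setoid

  -- Up to sign, the off-diagonal entries of `δ ⊘ γ` are the determinants of the pairs of
  -- corresponding rows.
  parallel-rows⇒≈ᴴ : ∀ γ δ → a δ * b γ ≈ b δ * a γ → c δ * d γ ≈ d δ * c γ → γ Ω.≈ δ
  parallel-rows⇒≈ᴴ γ δ p q = Ω.sym {δ} {γ} (diagonal⇒≈ᴴ δ γ
    ( trans (+-cong (sym (-‿distribʳ-* (a δ) (b γ))) (sym p)) (-‿inverseˡ (a δ * b γ))
    , trans (+-cong q (sym (-‿distribʳ-* (d δ) (c γ)))) (-‿inverseʳ (d δ * c γ))))
    where open RingProperties ring using (-‿distribʳ-*)

  -- Multiplying the first row by d and the second by b turns them into (ad, bd) and (bc, bd), whose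
  -- entries are invariant.
  generic-determined : ∀ {γ δ} → Scaled γ δ → Scaled (γ ⊙ lower) (δ ⊙ lower) →
                       ¬ b γ ≈ 0# → ¬ d γ ≈ 0# → γ Ω.≈ δ
  generic-determined {γ} {δ} S S′ b≉0 d≉0 = parallel-rows⇒≈ᴴ γ δ
    (proportional F b≉0 d≉0 (Scaled.ad-invariant S) bd)
    (proportional F d≉0 b≉0
      (trans (*-comm (c γ) (b γ)) (trans (Scaled.bc-invariant S) (*-comm (b δ) (c δ))))
      (trans (*-comm (d γ) (b γ)) (trans bd (*-comm (b δ) (d δ)))))
    where
    bd : b γ * d γ ≈ b δ * d δ
    bd = bd-invariant S S′

  b≈0⇒d≉0 : (M : SL₂ F) → b M ≈ 0# → ¬ d M ≈ 0#
  b≈0⇒d≉0 M b≈0 d≈0 = 1≉0 (begin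
    1#                ≈⟨ +-identityʳ 1# ⟨
    1# + 0#           ≈⟨ +-congˡ (trans (*-congʳ b≈0) (zeroˡ (c M))) ⟨
    1# + b M * c M    ≈⟨ det⁺ F (det M) ⟨
    a M * d M         ≈⟨ trans (*-congˡ d≈0) (zeroʳ (a M)) ⟩
    0#                ∎)
    where open SetoidReasoning setoid

  -- As `γ ⊘ (upper ⊙ γ)` is the inverse of `upper`, its lower left entry is 0, hence so is that of
  -- `δ ⊘ (upper ⊙ γ)`. Multiplying by `upper` on the right turns the latter into `δ ⊘ γ` and
  -- preserves the first column.
  upper-shares-row₂ : ∀ γ δ → Scaled (γ ⊘ (upper ⊙ γ)) (δ ⊘ (upper ⊙ γ)) → c (δ ⊘ γ) ≈ 0#
  upper-shares-row₂ γ δ S = begin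
    c (δ ⊘ γ)                   ≈⟨ proj₁ (proj₂ (proj₂ ([y//tx]t≈y//x SL₂-group upper γ δ))) ⟨
    c K * 1# + d K * 0#         ≈⟨ x1+y0 F (c K) (d K) ⟩
    c K                         ≈⟨ Scaled.c-zero S c≈0 ⟩
    0#                          ∎
    where
    open SetoidReasoning setoid
    K = δ ⊘ (upper ⊙ γ)
    c≈0 : c (γ ⊘ (upper ⊙ γ)) ≈ 0#
    c≈0 = trans (proj₁ (proj₂ (proj₂ (x//tx≈t⁻¹ SL₂-group upper γ)))) (-0≈0 F refl)

  lower-shares-row₁ : ∀ γ δ → Scaled (γ ⊘ (lower ⊙ γ)) (δ ⊘ (lower ⊙ γ)) → b (δ ⊘ γ) ≈ 0#
  lower-shares-row₁ γ δ S = begin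
    b (δ ⊘ γ)                   ≈⟨ proj₁ (proj₂ ([y//tx]t≈y//x SL₂-group lower γ δ)) ⟨
    a K * 0# + b K * 1#         ≈⟨ x0+y1 F (a K) (b K) ⟩
    b K                         ≈⟨ Scaled.b-zero S b≈0 ⟩
    0#                          ∎
    where
    open SetoidReasoning setoid
    K = δ ⊘ (lower ⊙ γ)
    b≈0 : b (γ ⊘ (lower ⊙ γ)) ≈ 0#
    b≈0 = trans (proj₁ (proj₂ (x//tx≈t⁻¹ SL₂-group lower γ))) (-0≈0 F refl)

  private
    row₁-parallel : ∀ γ δ → b γ ≈ 0# → b δ ≈ 0# → b (δ ⊘ γ) ≈ 0#
    row₁-parallel γ δ bγ≈0 bδ≈0 = trans (x*0+z*w (-0≈0 F bγ≈0)) (trans (*-congʳ bδ≈0) (zeroˡ (a γ)))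

    row₂-parallel : ∀ γ δ → d γ ≈ 0# → d δ ≈ 0# → c (δ ⊘ γ) ≈ 0#
    row₂-parallel γ δ dγ≈0 dδ≈0 = trans (x*y+0*w dδ≈0) (trans (*-congˡ dγ≈0) (zeroʳ (c δ)))

    -- The auxiliary cosets are generic: in the sum of the rows the second entry is whichever of b
    -- and d is nonzero.
    upper-b : ∀ γ → b γ ≈ 0# → ¬ b (upper ⊙ γ) ≈ 0#
    upper-b γ b≈0 b′≈0 = b≈0⇒d≉0 γ b≈0
      (trans (sym (trans (+-cong (trans (*-identityˡ (b γ)) b≈0) (*-identityˡ (d γ))) (+-identityˡ (d γ)))) b′≈0)

    upper-d : ∀ γ → b γ ≈ 0# → ¬ d (upper ⊙ γ) ≈ 0#
    upper-d γ b≈0 d′≈0 = b≈0⇒d≉0 γ b≈0 (trans (sym (0x+1y F (b γ) (d γ))) d′≈0)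

    lower-b : ∀ γ → ¬ b γ ≈ 0# → ¬ b (lower ⊙ γ) ≈ 0#
    lower-b γ b≉0 b′≈0 = b≉0 (trans (sym (1x+0y F (b γ) (d γ))) b′≈0)

    lower-d : ∀ γ → ¬ b γ ≈ 0# → d γ ≈ 0# → ¬ d (lower ⊙ γ) ≈ 0#
    lower-d γ b≉0 d≈0 d′≈0 = b≉0
      (trans (sym (trans (+-cong (*-identityˡ (b γ)) (trans (*-identityˡ (d γ)) d≈0)) (+-identityʳ (b γ)))) d′≈0)

  -- A pair (x , y) without the point (1 : 0) is determined from the origins alone.  If x is this point,
  -- then (x + y , y) is of the former kind and shares y with (x , y); if y is, then so does (x , x + y) with x.
  origins-separate : Separates (cartanScheme F) origin origin′
  origins-separate E E⇒origin E⇒origin′ transfer {γ} {δ} Eγδ = cases (_≟ᶠ_ F (b γ) 0#) (_≟ᶠ_ F (d γ) 0#)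
    where
    generic : ∀ {ε ε′} → ¬ b ε ≈ 0# → ¬ d ε ≈ 0# → E ε ε′ → ε Ω.≈ ε′
    generic {ε} {ε′} b≉0 d≉0 e =
      generic-determined {ε} {ε′} (origin-scaled ε ε′ (E⇒origin {ε} {ε′} e))
        (origin′-scaled ε ε′ (E⇒origin′ {ε} {ε′} e)) b≉0 d≉0

    through : ∀ ε → ¬ b ε ≈ 0# → ¬ d ε ≈ 0# → Scaled (γ ⊘ ε) (δ ⊘ ε)
    through ε b≉0 d≉0 = ∼⇒scaled ε γ δ (transfer {ε} (λ {ε′} e → generic {ε} {ε′} b≉0 d≉0 e) {γ} {δ} Eγδ)

    S : Scaled γ δ
    S = origin-scaled γ δ (E⇒origin {γ} {δ} Eγδ)

    cases : Dec (b γ ≈ 0#) → Dec (d γ ≈ 0#) → γ Ω.≈ δ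
    cases (no b≉0)  (no d≉0)  = generic {γ} {δ} b≉0 d≉0 Eγδ
    cases (yes b≈0) _         = Ω.sym {δ} {γ} (diagonal⇒≈ᴴ δ γ
      ( row₁-parallel γ δ b≈0 (Scaled.b-zero S b≈0)
      , upper-shares-row₂ γ δ (through (upper ⊙ γ) (upper-b γ b≈0) (upper-d γ b≈0))))
    cases (no b≉0)  (yes d≈0) = Ω.sym {δ} {γ} (diagonal⇒≈ᴴ δ γ
      ( lower-shares-row₁ γ δ (through (lower ⊙ γ) (lower-b γ b≉0) (lower-d γ b≉0 d≈0))
      , row₂-parallel γ δ d≈0 (Scaled.d-zero S d≈0)))

  -- Nontrivial point stabilizers and the lower bound.

  infixr 8 _^_
  _^_ : SL₂ F → SL₂ F → SL₂ F
  M ^ α = inv F α ⊙ (M ⊙ α)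

  diagonal-fixes : ∀ D α → IsDiagonal F D → (α ⊙ (D ^ α)) Ω.≈ α
  diagonal-fixes D α (b≈0 , c≈0) = diagonal⇒≈ᴴ (α ⊙ (D ^ α)) α
    ( trans (proj₁ (proj₂ ≈D)) b≈0 , trans (proj₁ (proj₂ (proj₂ ≈D))) c≈0)
    where
    ≈D : (α ⊙ (D ^ α)) ⊘ α SL.≈ D
    ≈D = conjugate SL₂-group α D

  -- Named for the contrapositive. If the coset is fixed, the upper right entry of `K` vanishes, so
  -- the first row of `K ⊙ upper` has equal entries, while that of `upper ⊙ D` is (a, d).
  diagonal-moves : ∀ D α → IsDiagonal F D → ((upper ⊙ α) ⊙ (D ^ α)) Ω.≈ (upper ⊙ α) → a D ≈ d D
  diagonal-moves D α (bD≈0 , cD≈0) p = begin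
    a D                    ≈⟨ trans (x*y+z*0 cD≈0) (*-identityˡ (a D)) ⟨
    1# * a D + 1# * c D    ≈⟨ proj₁ shifted ⟨
    a K * 1# + b K * 0#    ≈⟨ trans (x*y+0*w bK≈0) (sym (x*y+0*w bK≈0)) ⟩
    a K * 1# + b K * 1#    ≈⟨ proj₁ (proj₂ shifted) ⟩
    1# * b D + 1# * d D    ≈⟨ trans (x*0+z*w bD≈0) (*-identityˡ (d D)) ⟩
    d D                    ∎
    where
    open SetoidReasoning setoid
    K : SL₂ F
    K = ((upper ⊙ α) ⊙ (D ^ α)) ⊘ (upper ⊙ α)
    bK≈0 : b K ≈ 0#
    bK≈0 = proj₁ (≈ᴴ⇒diagonal ((upper ⊙ α) ⊙ (D ^ α)) (upper ⊙ α) p)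
    shifted : K ⊙ upper SL.≈ upper ⊙ D
    shifted = conjugate-shifted SL₂-group upper α D

  torus : ∀ t s → t * s ≈ 1# → SL₂ F
  torus t s ts≈1 = mat t 0# 0# s (det⁻ F (trans ts≈1 (sym (trans (+-congˡ (zeroˡ 0#)) (+-identityʳ 1#)))))

  diagonal-moves⇒¬isBase : ∀ D → IsDiagonal F D → ¬ a D ≈ d D →
                           ∀ α {Δ} → All (α Ω.≈_) Δ → ¬ IsBase (cartanScheme F) Δ
  diagonal-moves⇒¬isBase D D-diag a≉d α Δ≈α =
    stabilizer-moves⇒¬isBase (rightMultiplication (Cartan F)) α Δ≈α
      (D ^ α) (diagonal-fixes D α D-diag) (upper ⊙ α) (λ p → a≉d (diagonal-moves D α D-diag p))

  ∃-nonscalar-diagonal : q > 3 → ∃[ D ] IsDiagonal F D × ¬ a D ≈ d D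
  ∃-nonscalar-diagonal q>3 with t , ¬root ← ∃-nonroot F q>3 with s , ts≈1 ← invertible t (¬root ∘ inj₁) =
    torus t s ts≈1 , (refl , refl) , λ t≈s → ¬root (inj₂ (trans (*-congˡ t≈s) ts≈1))

  singleton-¬isBase : q > 3 → ∀ α {Δ} → All (α Ω.≈_) Δ → ¬ IsBase (cartanScheme F) Δ
  singleton-¬isBase q>3 =
    let D , D-diag , a≉d = ∃-nonscalar-diagonal q>3 in diagonal-moves⇒¬isBase D D-diag a≉d

  origins-distinct : ¬ origin Ω.≈ origin′
  origins-distinct p = 1≉0 (begin
    1#                          ≈⟨ ⁻¹-involutive 1# ⟨
    - - 1#                      ≈⟨ 0x+1y F 1# (- - 1#) ⟨
    0# * 1# + 1# * - - 1#       ≈⟨ proj₂ (≈ᴴ⇒diagonal origin origin′ p) ⟩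
    0#                          ∎)
    where
    open GroupProperties +-group using (⁻¹-involutive)
    open SetoidReasoning setoid

theorem1p4 : (q : ℕ) → IsPrimePower q → q > 3 → (F : FieldOfOrder q) →
    IsSeparable 2 (cartanScheme F) × IsBaseNumber (cartanScheme F) 2
theorem1p4 q _ q>3 F =
    separates⇒2-separable (cartanScheme F) (origin F) (origin′ F) (origins-separate F)
  , ( origin F ∷ origin′ F ∷ [] , (origins-distinct F ∷ []) ∷ [] ∷ [] , ≡.refl
    , separates⇒isBase (cartanScheme F) (origin F) (origin′ F) (origins-separate F))
  -- For the empty list any point may serve as the one whose stabilizer is used.
  , λ { _ ([]        , _ , _      , base) → contradiction base (singleton-¬isBase F q>3 (origin F) {[]} [])
      ; _ (α ∷ []    , _ , _      , base) → contradiction base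
          (singleton-¬isBase F q>3 α {α ∷ []} (FiniteSet.refl (rightCosets (Cartan F)) {α} ∷ []))
      ; _ (_ ∷ _ ∷ _ , _ , ≡.refl , _)    → s≤s (s≤s z≤n)
      }
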